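{- Let $b_n$ be the number of freely-braided hexagon-avoiding permutations in $S_n$ and let $m_n$ be the number of maximally-clustered hexagon-avoiding permutations in $S_n$. Then for all $n\ge 9$, $$b_{n+1}=6b_n-9b_{n-1}+3b_{n-2}+b_{n-3}-8b_{n-4}-b_{n-5}+b_{n-6}$$ and $$m_{n+1}=7m_n-15m_{n-1}+14m_{n-2}-8m_{n-3}-4m_{n-4}+3m_{n-5},$$ with initial conditions $$(b_3,b_4,\dots,b_9)=(6,20,71,260,971,3670,13968),\qquad (m_3,m_4,\dots,m_9)=(6,21,78,298,1157,4535,17872).$$
   Context: All avoidance is classical (one-line notation) permutation pattern avoidance. A permutation is freely braided if it avoids $[4231],[3421],[4312],[4321]$; it is maximally clustered if it avoids $[3421],[4312],[4321]$. Hexagon-avoiding permutations are those avoiding $[46718235],[46781235],[56718234],[56781234]$. Thus "freely-braided hexagon-avoiding" (respectively "maximally-clustered hexagon-avoiding") means avoiding all patterns of both lists. -}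

module Defs where

open import Data.Fin using (Fin; zero; suc; _<_; punchIn)
open import Data.Fin.Permutation using (Permutation′; id; insert; remove; insert-remove; insert-punchIn; _⟨$⟩ʳ_; _≈_)
open import Data.Fin.Properties using (_<?_; any?; all?; punchIn-injective)
open import Data.List using (List; []; _∷_; length; filter; allFin; cartesianProductWith)
import Data.List as List
import Data.List.Membership.Setoid as Membership
open import Data.List.Membership.Setoid.Properties using (∈-cartesianProductWith⁺; ∈-resp-≈)
open import Data.List.Membership.Propositional.Properties using (∈-allFin)
open import Data.List.Relation.Unary.All using (All; []; _∷_)
import Data.List.Relation.Unary.All as All
open import Data.List.Relation.Unary.AllPairs using ([]; _∷_)
open import Data.List.Relation.Unary.Any using (here)
import Data.List.Relation.Unary.Unique.Setoid as Uniqueness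
import Data.List.Relation.Unary.Unique.Setoid.Properties as Uniqueₚ
import Data.List.Relation.Unary.Unique.Propositional.Properties as Unique≡ₚ
open import Data.Nat using (ℕ; zero; suc)
import Data.Nat as ℕ
import Data.Nat.Properties as ℕₚ
open import Data.Product using (∃; _×_; _,_)
open import Data.Vec using (Vec; []; _∷_; lookup)
open import Function using (_⇔_; mk⇔; Equivalence)
open import Level using (0ℓ)
open import Relation.Binary using (Setoid)
open import Relation.Binary.PropositionalEquality using (_≡_; refl; sym; trans; cong; setoid)
open import Relation.Nullary using (¬_; Dec; ¬?; _×-dec_; _→-dec_)
open import Relation.Nullary.Decidable using (map′)
open import Relation.Unary using (Pred; Decidable)

-- A pattern in one-line notation; only the relative order of the letters
-- matters.  The one-line notation of π : Permutation′ n is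
-- π ⟨$⟩ʳ 0, …, π ⟨$⟩ʳ (n − 1), with values counted from 0.
Pattern : Set
Pattern = List ℕ

-- The entries of ι are the positions of an occurrence of p in π.
IsOccurrence : ∀ {n} (p : Pattern) → Permutation′ n → Pred (Vec (Fin n) (length p)) 0ℓ
IsOccurrence p π ι = ∀ i j →
  (i < j → lookup ι i < lookup ι j) ×
  (List.lookup p i ℕ.< List.lookup p j ⇔ π ⟨$⟩ʳ lookup ι i < π ⟨$⟩ʳ lookup ι j)

Contains : ∀ {n} → Pattern → Pred (Permutation′ n) 0ℓ
Contains p π = ∃ λ ι → IsOccurrence p π ι

Avoids : ∀ {n} → List Pattern → Pred (Permutation′ n) 0ℓ
Avoids ps π = All (λ p → ¬ Contains p π) ps

maximallyClusteredPatterns freelyBraidedPatterns hexagonPatterns : List Pattern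
maximallyClusteredPatterns =
  (3 ∷ 4 ∷ 2 ∷ 1 ∷ []) ∷
  (4 ∷ 3 ∷ 1 ∷ 2 ∷ []) ∷
  (4 ∷ 3 ∷ 2 ∷ 1 ∷ []) ∷ []
freelyBraidedPatterns =
  (4 ∷ 2 ∷ 3 ∷ 1 ∷ []) ∷
  (3 ∷ 4 ∷ 2 ∷ 1 ∷ []) ∷
  (4 ∷ 3 ∷ 1 ∷ 2 ∷ []) ∷
  (4 ∷ 3 ∷ 2 ∷ 1 ∷ []) ∷ []
hexagonPatterns =
  (4 ∷ 6 ∷ 7 ∷ 1 ∷ 8 ∷ 2 ∷ 3 ∷ 5 ∷ []) ∷
  (4 ∷ 6 ∷ 7 ∷ 8 ∷ 1 ∷ 2 ∷ 3 ∷ 5 ∷ []) ∷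
  (5 ∷ 6 ∷ 7 ∷ 1 ∷ 8 ∷ 2 ∷ 3 ∷ 4 ∷ []) ∷
  (5 ∷ 6 ∷ 7 ∷ 8 ∷ 1 ∷ 2 ∷ 3 ∷ 4 ∷ []) ∷ []

FreelyBraided MaximallyClustered HexagonAvoiding : ∀ {n} → Pred (Permutation′ n) 0ℓ
FreelyBraided      = Avoids freelyBraidedPatterns
MaximallyClustered = Avoids maximallyClusteredPatterns
HexagonAvoiding    = Avoids hexagonPatterns

anyVec? : ∀ {n k} {P : Pred (Vec (Fin n) k) 0ℓ} → Decidable P → Dec (∃ P)
anyVec? {k = zero}  P? = map′ (λ q → [] , q) (λ { ([] , q) → q }) (P? [])
anyVec? {k = suc k} P? =
  map′ (λ { (x , xs , q) → x ∷ xs , q }) (λ { (x ∷ xs , q) → x , xs , q })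
       (any? λ x → anyVec? λ xs → P? (x ∷ xs))

isOccurrence? : ∀ {n} p (π : Permutation′ n) → Decidable (IsOccurrence p π)
isOccurrence? p π ι = all? λ i → all? λ j →
  (i <? j →-dec lookup ι i <? lookup ι j) ×-dec
  (List.lookup p i ℕₚ.<? List.lookup p j ⇔? π ⟨$⟩ʳ lookup ι i <? π ⟨$⟩ʳ lookup ι j)
  where
  infix 3 _⇔?_
  _⇔?_ : {A B : Set} → Dec A → Dec B → Dec (A ⇔ B)
  a? ⇔? b? = map′ (λ { (f , g) → mk⇔ f g }) (λ e → Equivalence.to e , Equivalence.from e)
                  ((a? →-dec b?) ×-dec (b? →-dec a?))

contains? : ∀ {n} p → Decidable (Contains {n} p)
contains? p π = anyVec? (isOccurrence? p π)

avoids? : ∀ {n} ps → Decidable (Avoids {n} ps)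
avoids? ps π = All.all? (λ p → ¬? (contains? p π)) ps

-- Each element of Sₙ exactly once, up to _≈_: see permutations-complete and
-- permutations-unique.
permutations : ∀ n → List (Permutation′ n)
permutations zero    = id ∷ []
permutations (suc n) = cartesianProductWith (insert zero) (allFin (suc n)) (permutations n)

count : ∀ {n} {P : Pred (Permutation′ n) 0ℓ} → Decidable P → ℕ
count {n} P? = length (filter P? (permutations n))

b : ℕ → ℕ
b n = count {n} {λ π → FreelyBraided π × HexagonAvoiding π}
  λ π → avoids? freelyBraidedPatterns π ×-dec avoids? hexagonPatterns π

m : ℕ → ℕ
m n = count {n} {λ π → MaximallyClustered π × HexagonAvoiding π}
  λ π → avoids? maximallyClusteredPatterns π ×-dec avoids? hexagonPatterns π

permutationSetoid : ℕ → Setoid 0ℓ 0ℓ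
permutationSetoid n = record
  { Carrier       = Permutation′ n
  ; _≈_           = _≈_
  ; isEquivalence = record
    { refl  = λ _ → refl
    ; sym   = λ π≈ρ i → sym (π≈ρ i)
    ; trans = λ π≈ρ ρ≈σ i → trans (π≈ρ i) (ρ≈σ i)
    }
  }

private
  insert₀-cong : ∀ {n} {j k : Fin (suc n)} {π ρ : Permutation′ n} →
                 j ≡ k → π ≈ ρ → insert zero j π ≈ insert zero k ρ
  insert₀-cong j≡k π≈ρ zero = j≡k
  insert₀-cong {j = j} {π = π} {ρ} refl π≈ρ (suc i) =
    trans (insert-punchIn zero j π i)
      (trans (cong (punchIn j) (π≈ρ i)) (sym (insert-punchIn zero j ρ i)))

  insert₀-injective : ∀ {n} {j k : Fin (suc n)} {π ρ : Permutation′ n} →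
                      insert zero j π ≈ insert zero k ρ → j ≡ k × π ≈ ρ
  insert₀-injective {j = j} {k} {π} {ρ} eq with refl ← eq zero =
    refl , λ i → punchIn-injective j _ _
      (trans (sym (insert-punchIn zero j π i)) (trans (eq (suc i)) (insert-punchIn zero j ρ i)))

permutations-complete : ∀ n (π : Permutation′ n) →
                        Membership._∈_ (permutationSetoid n) π (permutations n)
permutations-complete zero    π = here λ ()
permutations-complete (suc n) π =
  ∈-resp-≈ (permutationSetoid (suc n)) {x = insert zero (π ⟨$⟩ʳ zero) (remove zero π)} {π} (insert-remove zero π)
    (∈-cartesianProductWith⁺ (setoid (Fin (suc n))) (permutationSetoid n) (permutationSetoid (suc n))
      {f = insert zero} (λ {_} {_} {π} {ρ} → insert₀-cong {π = π} {ρ})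
      (∈-allFin (π ⟨$⟩ʳ zero)) (permutations-complete n (remove zero π)))

permutations-unique : ∀ n → Uniqueness.Unique (permutationSetoid n) (permutations n)
permutations-unique zero    = [] ∷ []
permutations-unique (suc n) =
  Uniqueₚ.cartesianProductWith⁺ (setoid (Fin (suc n))) (permutationSetoid n) (permutationSetoid (suc n))
    (insert zero) (λ {_} {_} {π} {ρ} → insert₀-injective {π = π} {ρ})
    (Unique≡ₚ.allFin⁺ (suc n)) (permutations-unique n)

{-# OPTIONS --safe #-}
module Submission where

open import Defs
open import Data.Nat using (ℕ; suc; _∸_; _≤_)
open import Data.Product using (_×_)
open import Relation.Binary.PropositionalEquality using (_≡_)

-- Insertion encoding: a permutation is written from left to right.  What matters for the letters to come are
-- the maximal intervals of unused values (slots), and for every partial occurrence of a forbidden pattern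
-- its remaining letters together with the slots each of them may come from.  If several slots are open, they
-- must all be used eventually, which soon forces an occurrence.  So up to redundancy only finitely
-- many states have a completion: the permutations are counted by the powers of a finite transfer matrix,
-- and a linear recurrence for them is a finite computation.

-- Recording the sizes of the slots would give infinitely many states. They disappear because a
-- state is counted for all sizes at once: `completions` sums over the compositions of `n` into one
-- positive part per slot, and its recursion in `n` involves only the number of slots and the
-- suffixes. A played value splits its slot into two parts, either of which may be empty; discarding
-- the empty parts yields the four moves. Two reductions make the state set finite: a suffix is
-- dropped when each of its occurrences contains an occurrence of another one, and states without
-- completions collapse to `hopeless`. Both are proved to preserve the count; that the resulting
-- list of states is closed under moves is then a computation. The stated recurrence concerns one
-- entry of the vector of counts and need not annihilate the vector, hence the cofactor polynomials.

module Enumeration where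

  open import Data.Bool using (Bool; true; false; if_then_else_; _∧_; _∨_; T)
  open import Data.Bool.ListAction using (any; all)
  open import Data.Bool.Properties using (T-∧; T-∨)
  open import Data.Empty using (⊥; ⊥-elim)
  open import Data.Fin as Fin using (Fin; zero; suc; #_; fromℕ<; punchIn; punchOut; toℕ)
  open import Data.Fin.Permutation using (Permutation′; _⟨$⟩ʳ_; _⟨$⟩ˡ_; insert-punchIn; inverseʳ; inverseˡ)
    renaming (insert to insertₚ)
  import Data.Fin.Properties as Finₚ
  open import Data.Integer as ℤ using (ℤ; 0ℤ; 1ℤ)
  import Data.Integer.Properties as ℤₚ
  open import Data.Integer.Tactic.RingSolver using (solve-∀)
  open import Data.List using (List; []; _∷_; _++_; allFin; applyUpTo; cartesianProductWith; concat; concatMap;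
    filter; filterᵇ; foldr; length; lookup; map; null; reverse; tabulate)
  import Data.List.Properties as Listₚ
  open import Data.List.Membership.Propositional using (_∈_)
  open import Data.List.Membership.Propositional.Properties using (∈-applyUpTo⁺)
  open import Data.List.Relation.Binary.Pointwise using (Pointwise; []; _∷_)
  open import Data.List.Relation.Binary.Sublist.Propositional using (_⊆_; []; _∷_; _∷ʳ_; minimum)
  open import Data.List.Relation.Unary.All as All using (All; []; _∷_)
  import Data.List.Relation.Unary.All.Properties as Allₚ
  open import Data.List.Relation.Unary.Any as Any using (Any; here; there)
  import Data.List.Relation.Unary.Any.Properties as Anyₚ
  open import Data.Maybe using (Maybe; just; nothing)
  open import Data.Nat
  open import Data.Nat.ListAction using (sum)
  open import Data.Nat.ListAction.Properties using (sum-++)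
  open import Data.Nat.Properties
  open import Algebra.Properties.CommutativeSemigroup +-commutativeSemigroup using (interchange)
  open import Data.Product using (∃; _×_; _,_; proj₁; proj₂)
  import Data.Product.Properties as Productₚ
  open import Data.Sum using (_⊎_; inj₁; inj₂; [_,_]; [_,_]′)
  open import Data.Unit using (⊤)
  import Data.Vec as Vec
  import Data.Vec.Properties as Vecₚ
  open import Function using (_∘_; id; mk⇔; Equivalence)
  open import Level using (0ℓ)
  open import Relation.Binary using (DecidableEquality; _Preserves_⟶_; tri<; tri≈; tri>)
  open import Relation.Binary.PropositionalEquality hiding ([_])
  open import Relation.Nullary using (¬_; Dec; yes; no; does; ¬?; _×-dec_; _⊎-dec_; _→-dec_)
  open import Relation.Nullary.Decidable using (True; map′; toWitness; ⌊_⌋)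
  open import Relation.Unary using (Pred; Decidable)
  open ≡-Reasoning

  -- Suffixes, states and moves

  -- The letter a of a forbidden pattern, to be played by a value v with l ≤ v < h.  In the suffixes of a
  -- State the bounds count slots instead of values.  Equal letters of a suffix are not compared.
  data Letter : Set where
    letter : (a l h : ℕ) → Letter

  Suffix = List Letter

  _≟ˡ_ : DecidableEquality Letter
  letter a l h ≟ˡ letter a′ l′ h′ =
    map′ (λ { refl → refl }) (λ { refl → refl }) ((a , l , h) ≟³ (a′ , l′ , h′))
    where _≟³_ = Productₚ.≡-dec _≟_ (Productₚ.≡-dec _≟_ _≟_)

  -- The number of slots, that is, of nonempty intervals of values not yet used, and the suffixes of
  -- forbidden patterns whose occurrence among the letters to come is forbidden.
  State = ℕ × List Suffix

  _≟ˢ_ : DecidableEquality State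
  _≟ˢ_ = Productₚ.≡-dec _≟_ (Listₚ.≡-dec (Listₚ.≡-dec _≟ˡ_))

  shift : (ℕ → ℕ) → Letter → Letter
  shift σ (letter a l h) = letter a (σ l) (σ h)

  -- The letter a has been played: larger letters must exceed the cut c, smaller ones stay below d.
  refine : ℕ → ℕ → ℕ → Letter → Letter
  refine a c d (letter b l h) = letter b (if a <ᵇ b then l ⊔ c else l) (if b <ᵇ a then h ⊓ d else h)

  -- A letter in slot i either is ignored by an occurrence or plays its first letter.  Cuts move by σ, and c
  -- is the cut at the new letter.
  use : (ℕ → ℕ) → ℕ → ℕ → Suffix → List Suffix
  use σ i c [] = []
  use σ i c (letter a l h ∷ r) = if (l ≤ᵇ i) ∧ (i <ᵇ h) then map (refine a c c ∘ shift σ) r ∷ [] else []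

  advance : (ℕ → ℕ) → ℕ → ℕ → Suffix → List Suffix
  advance σ i c r = map (shift σ) r ∷ use σ i c r

  step : (ℕ → ℕ) → ℕ → ℕ → List Suffix → List Suffix
  step σ i c = concatMap (advance σ i c)

  -- These renumber cuts, the boundaries of slots: slot `i` lies between the cuts `i` and `i + 1`.
  -- `down i` merges these two cuts; `up i` leaves the number `i + 1` free for a new cut inside the
  -- slot.
  down up : ℕ → ℕ → ℕ
  down zero    zero    = zero
  down zero    (suc k) = k
  down (suc j) zero    = zero
  down (suc j) (suc k) = suc (down j k)
  up zero    zero    = zero
  up zero    (suc k) = suc (suc k)
  up (suc j) zero    = zero
  up (suc j) (suc k) = suc (up j k)

  -- A letter in slot i leaves behind no slot, a slot on its right or left only, or two slots; left and right
  -- name the end of the slot where it is placed.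
  fill left right middle : ℕ → List Suffix → List Suffix
  fill   i = step (down i) i i
  left   i = step id i i
  right  i = step id i (suc i)
  middle i = step (up i) i (suc i)

  movesAt : ℕ → List Suffix → ℕ → List State
  movesAt s A i = (pred s , fill i A) ∷ (s , left i A) ∷ (s , right i A) ∷ (suc s , middle i A) ∷ []

  moves : State → List State
  moves (s , A) = concat (applyUpTo (movesAt s A) s)

  proper : Suffix → Bool
  proper []                 = true
  proper (letter a l h ∷ r) = (l <ᵇ h) ∧ proper r

  forced : ℕ → Suffix → Bool
  forced s []                    = true
  forced s (letter a l h ∷ [])   = (l <ᵇ h) ∧ (l <ᵇ s)
  forced s (_ ∷ _ ∷ _)           = false

  -- Tests for dead states and redundant suffixes

  -- Suffixes with more letters than there are slots cannot be completed by one value per slot.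
  relevant : ℕ → List Suffix → List Suffix
  relevant s = filterᵇ λ r → (length r ≤ᵇ s) ∧ proper r

  -- Every completion uses at least one value of each slot; a state is dead if the choice of a single value
  -- per slot creates an occurrence in whatever order these values are played.
  dead? : ℕ → List Suffix → Bool
  dead? zero    A = any (forced zero) A
  dead? (suc s) A = any (forced (suc s)) A ∨ all (λ i → dead? s (relevant s (fill i A))) (applyUpTo id (suc s))

  -- Second components belong to the suffix whose occurrence is to be deduced: each strict
  -- comparison between them must already hold between the first components.
  consistent : ℕ → ℕ → List (ℕ × ℕ) → Bool
  consistent a b [] = true
  consistent a b ((c , d) ∷ P) =
    (if d <ᵇ b then c <ᵇ a else if b <ᵇ d then a <ᵇ c else true) ∧ consistent a b P

  -- The list holds the pairs of letters already matched, the number is how many letters may still be dropped.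
  embeds : List (ℕ × ℕ) → ℕ → Suffix → Suffix → Bool
  drops  : List (ℕ × ℕ) → ℕ → Suffix → Suffix → Bool
  embeds P k []      f       = null f
  embeds P k (x ∷ e) []      = true
  embeds P k (letter a l h ∷ e) (letter b l′ h′ ∷ f) =
    ((l′ ≤ᵇ l) ∧ (h ≤ᵇ h′) ∧ consistent a b P ∧ embeds ((a , b) ∷ P) k e f) ∨ drops P k e (letter b l′ h′ ∷ f)
  drops P zero    e f = false
  drops P (suc k) e f = embeds P k e f

  standardise : Suffix → Suffix
  standardise r = map (λ { (letter a l h) → letter (length (filterᵇ (λ { (letter b _ _) → b <ᵇ a }) r)) l h }) r

  -- Embeddings in both directions certify that `r` and `r′` occur in the same words; without this
  -- certificate the original suffix is kept.
  checked : Suffix → Suffix → Suffix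
  checked r r′ = if embeds [] 0 r r′ ∧ embeds [] 0 r′ r then r′ else r

  -- Shorter suffixes first, wider ones first among those of equal length, so that a suffix can only be
  -- redundant because of an earlier one.  Collisions of codes could only make the check closed fail.
  code : Suffix → ℕ
  code r = (length r * 64 + (63 ∸ foldr (λ { (letter a l h) w → (h ∸ l) + w }) 0 r)) * 2 ^ 54
           + foldr (λ { (letter a l h) k → k * 512 + (a * 64 + l * 8 + h) }) 0 r

  Coded = ℕ × Suffix

  encode : Suffix → Coded
  encode r = code r , r

  insert : Coded → List Coded → List Coded
  insert x [] = x ∷ []
  insert x (y ∷ ys) = if proj₁ x <ᵇ proj₁ y then x ∷ y ∷ ys else y ∷ insert x ys

  redundant : ℕ → Suffix → List Suffix → Bool
  redundant n r = any λ f → embeds [] (n ∸ length f) r f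

  prune : List Suffix → List Coded → List Suffix
  prune acc []             = reverse acc
  prune acc ((_ , r) ∷ xs) = if redundant (length r) r acc then prune acc xs else prune (r ∷ acc) xs

  normalise : List Suffix → List Suffix
  normalise A = prune [] (foldr (λ r → insert (encode (checked r (standardise r)))) [] (filterᵇ proper A))

  -- No slot is left, so there are no moves, and the forbidden empty suffix occurs even in the empty
  -- word.
  hopeless : State
  hopeless = 0 , [] ∷ []

  outcome : State → State
  outcome (s , A) = if dead? s (relevant s A) then hopeless else (s , normalise A)

  stateCode : State → ℕ
  stateCode (s , A) = foldr (λ r z → z * 2 ^ 66 + code r) s A

  -- The automaton and its check

  -- States are numbered, 0 is hopeless.  The targets are the numbers of the successors.
  record Node : Set where
    constructor node
    field
      state       : State
      successors  : List State
      targets     : List ℕ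
      -- Storing this equation lets `closed` compare with the list computed during the search.
      successors≡ : successors ≡ map outcome (moves state)

  record Register : Set where
    constructor register
    field
      size  : ℕ
      index : List (ℕ × ℕ)
      fresh : List State

  find : ℕ → List (ℕ × ℕ) → Maybe ℕ
  find k [] = nothing
  find k ((k′ , i) ∷ ks) = if k ≡ᵇ k′ then just i else find k ks

  cons : ℕ → List ℕ × Register → List ℕ × Register
  cons i (is , R) = i ∷ is , R

  -- Breadth-first search.  It needs no proof, since closed below checks its result.  It is split into
  -- auxiliary functions because the evaluator shares arguments but duplicates let- and where-bound terms.
  visit  : List State → Register → List ℕ × Register
  visit₁ : State → ℕ → Maybe ℕ → List State → Register → List ℕ × Register
  visit₂ : State → ℕ → List State → Register → List ℕ × Register
  visit []       R = [] , R
  visit (q ∷ qs) R = visit₂ q (stateCode q) qs R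
  visit₂ q k qs R = visit₁ q k (find k (Register.index R)) qs R
  visit₁ q k (just i) qs R = cons i (visit qs R)
  visit₁ q k nothing qs (register n index fresh) =
    cons n (visit qs (register (suc n) ((k , n) ∷ index) (q ∷ fresh)))

  explore  : ℕ → List State → Register → List Node
  explore₁ : ℕ → (q : State) (qs′ : List State) → qs′ ≡ map outcome (moves q) →
             List State → List ℕ × Register → List Node
  explore₂ : ℕ → (q : State) (qs′ : List State) → qs′ ≡ map outcome (moves q) →
             List State → Register → List Node
  explore zero _ _ = []
  explore (suc n) [] (register k index []) = []
  explore (suc n) [] (register k index fresh@(_ ∷ _)) = explore n (reverse fresh) (register k index [])
  explore (suc n) (q ∷ qs) R = explore₂ n q (map outcome (moves q)) refl qs R
  explore₂ n q qs′ eq qs R = explore₁ n q qs′ eq qs (visit qs′ R)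
  explore₁ n q qs′ eq qs (is , R) = node q qs′ is eq ∷ explore n qs R

  -- The number 1000 is a generous bound on the rounds of the search. A list cut short would be
  -- rejected by `valid?`, since a missing number reads as `hopeless` in `stateAt`.
  automaton : State → List Node
  automaton q = explore 1000 (hopeless ∷ q ∷ [])
    (register 2 ((stateCode q , 1) ∷ (stateCode hopeless , 0) ∷ []) [])

  -- The default `hopeless` has no completions, in agreement with the default entry 0 of vectors in
  -- `at`.
  stateAt : List Node → ℕ → State
  stateAt []       _       = hopeless
  stateAt (x ∷ _)  zero    = Node.state x
  stateAt (_ ∷ xs) (suc k) = stateAt xs k

  matches : List Node → List State → List ℕ → Bool
  matches M []       []       = true
  matches M (q ∷ qs) (k ∷ ks) = does (q ≟ˢ stateAt M k) ∧ matches M qs ks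
  matches M _        _        = false

  closed : List Node → Bool
  closed M = all (λ x → matches M (Node.successors x) (Node.targets x)) M

  -- Occurrences of suffixes in words

  Monotone : (ℕ → ℕ) → Set
  Monotone σ = σ Preserves _≤_ ⟶ _≤_

  -- A letter played by x makes x a bound for the remaining letters, so the bounds alone ensure that an
  -- occurrence is ordered like the pattern.
  infix 4 _⊨_
  data _⊨_ : List ℕ → Suffix → Set where
    done : ∀ {w} → w ⊨ []
    skip : ∀ {x w r} → w ⊨ r → x ∷ w ⊨ r
    take : ∀ {x w a l h r} → l ≤ x → x < h → w ⊨ map (refine a (suc x) x) r → x ∷ w ⊨ letter a l h ∷ r

  _⊨?_ : ∀ w r → Dec (w ⊨ r)
  w       ⊨? []                 = yes done
  []      ⊨? (_ ∷ _)            = no λ ()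
  (x ∷ w) ⊨? (letter a l h ∷ r) = map′
    (λ { (inj₁ p) → skip p ; (inj₂ ((l≤x , x<h) , p)) → take l≤x x<h p })
    (λ { (skip p) → inj₁ p ; (take l≤x x<h p) → inj₂ ((l≤x , x<h) , p) })
    ((w ⊨? (letter a l h ∷ r)) ⊎-dec ((l ≤? x) ×-dec (x <? h)) ×-dec (w ⊨? map (refine a (suc x) x) r))

  Hit : List ℕ → List Suffix → Set
  Hit w = Any (w ⊨_)

  -- Deletion of a value

  punch : ℕ → ℕ → ℕ
  punch zero    u       = suc u
  punch (suc j) zero    = zero
  punch (suc j) (suc u) = suc (punch j u)

  toℕ-punchIn : ∀ {n} (j : Fin (suc n)) (u : Fin n) → toℕ (punchIn j u) ≡ punch (toℕ j) (toℕ u)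
  toℕ-punchIn zero    u       = refl
  toℕ-punchIn (suc j) zero    = refl
  toℕ-punchIn (suc j) (suc u) = cong suc (toℕ-punchIn j u)

  down-mono : ∀ j → Monotone (down j)
  down-mono zero    z≤n       = z≤n
  down-mono zero    (s≤s p)   = p
  down-mono (suc j) z≤n       = z≤n
  down-mono (suc j) (s≤s p)   = s≤s (down-mono j p)

  -- With its converse below this is a Galois connection between `down j` and `punch j`: relabelling
  -- the values of a word amounts to moving the bounds of the letters. Upper bounds follow by
  -- negation.
  down-≤ : ∀ j c u → c ≤ punch j u → down j c ≤ u
  down-≤ zero    zero    u       p       = z≤n
  down-≤ zero    (suc c) u       (s≤s p) = p
  down-≤ (suc j) zero    u       p       = z≤n
  down-≤ (suc j) (suc c) (suc u) (s≤s p) = s≤s (down-≤ j c u p)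

  ≤-down : ∀ j c u → down j c ≤ u → c ≤ punch j u
  ≤-down zero    zero    u       p       = z≤n
  ≤-down zero    (suc c) u       p       = s≤s p
  ≤-down (suc j) zero    u       p       = z≤n
  ≤-down (suc j) (suc c) (suc u) (s≤s p) = s≤s (≤-down j c u p)

  down-> : ∀ j c u → punch j u < c → u < down j c
  down-> j c u p = ≰⇒> (<⇒≱ p ∘ ≤-down j c u)

  >-down : ∀ j c u → u < down j c → punch j u < c
  >-down j c u p = ≰⇒> (<⇒≱ p ∘ down-≤ j c u)

  down-punch : ∀ j u → down j (punch j u) ≡ u
  down-punch zero    u       = refl
  down-punch (suc j) zero    = refl
  down-punch (suc j) (suc u) = cong suc (down-punch j u)

  down-suc-punch : ∀ j u → down j (suc (punch j u)) ≡ suc u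
  down-suc-punch zero          u       = refl
  down-suc-punch (suc zero)    zero    = refl
  down-suc-punch (suc (suc j)) zero    = refl
  down-suc-punch (suc j)       (suc u) = cong suc (down-suc-punch j u)

  down-self : ∀ j → down j j ≡ j
  down-self zero    = refl
  down-self (suc j) = cong suc (down-self j)

  down-suc-self : ∀ j → down j (suc j) ≡ j
  down-suc-self zero    = refl
  down-suc-self (suc j) = cong suc (down-suc-self j)

  shift-refine : ∀ {τ} → Monotone τ → ∀ a c d e →
                 shift τ (refine a c d e) ≡ refine a (τ c) (τ d) (shift τ e)
  shift-refine {τ} mono a c d (letter b l h) = cong₂ (letter b) (low (a <ᵇ b)) (high (b <ᵇ a))
    where
    low : ∀ x → τ (if x then l ⊔ c else l) ≡ (if x then τ l ⊔ τ c else τ l)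
    low true  = mono-≤-distrib-⊔ mono l c
    low false = refl
    high : ∀ x → τ (if x then h ⊓ d else h) ≡ (if x then τ h ⊓ τ d else τ h)
    high true  = mono-≤-distrib-⊓ mono h d
    high false = refl

  shift-refines : ∀ {τ} → Monotone τ → ∀ a c d r →
                  map (shift τ) (map (refine a c d) r) ≡ map (refine a (τ c) (τ d)) (map (shift τ) r)
  shift-refines mono a c d r =
    trans (sym (Listₚ.map-∘ r)) (trans (Listₚ.map-cong (shift-refine mono a c d) r) (Listₚ.map-∘ r))

  ⊨-down : ∀ j w {r} → map (punch j) w ⊨ r → w ⊨ map (shift (down j)) r
  ⊨-down j []      done     = done
  ⊨-down j (x ∷ w) done     = done
  ⊨-down j (x ∷ w) (skip p) = skip (⊨-down j w p)
  ⊨-down j (x ∷ w) {letter a l h ∷ r} (take p q s) =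
    take (down-≤ j l x p) (down-> j h x q) (subst (w ⊨_) eq (⊨-down j w s))
    where
    eq : map (shift (down j)) (map (refine a (suc (punch j x)) (punch j x)) r) ≡
         map (refine a (suc x) x) (map (shift (down j)) r)
    eq = trans (shift-refines (down-mono j) a _ _ r)
               (cong₂ (λ c d → map (refine a c d) _) (down-suc-punch j x) (down-punch j x))

  ⊨-up : ∀ j w {r} → w ⊨ map (shift (down j)) r → map (punch j) w ⊨ r
  ⊨-up j w       {[]}    _        = done
  ⊨-up j (x ∷ w) {letter _ _ _ ∷ _} (skip p) = skip (⊨-up j w p)
  ⊨-up j (x ∷ w) {letter a l h ∷ r} (take p q s) =
    take (≤-down j l x p) (>-down j h x q) (⊨-up j w (subst (w ⊨_) (sym eq) s))
    where
    eq : map (shift (down j)) (map (refine a (suc (punch j x)) (punch j x)) r) ≡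
         map (refine a (suc x) x) (map (shift (down j)) r)
    eq = trans (shift-refines (down-mono j) a _ _ r)
               (cong₂ (λ c d → map (refine a c d) _) (down-suc-punch j x) (down-punch j x))

  if-true : ∀ {A : Set} {b} {x y : A} → T b → (if b then x else y) ≡ x
  if-true {b = true} _ = refl

  -- The cuts `j` and `suc j` on the two sides of the played value coincide once it is deleted, so a
  -- single cut bounds both the larger and the smaller letters.
  take-eq : ∀ j a r → map (shift (down j)) (map (refine a (suc j) j) r) ≡ map (refine a j j ∘ shift (down j)) r
  take-eq j a r = trans (shift-refines (down-mono j) a _ _ r)
    (trans (cong₂ (λ c d → map (refine a c d) (map (shift (down j)) r)) (down-suc-self j) (down-self j))
      (sym (Listₚ.map-∘ r)))

  ⊨-advance : ∀ j w r → j ∷ map (punch j) w ⊨ r → Hit w (advance (down j) j j r)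
  ⊨-advance j w r                  (skip p)     = here (⊨-down j w p)
  ⊨-advance j w []                 done         = here done
  ⊨-advance j w (letter a l h ∷ r) (take p q s) =
    there (subst (Hit w) (sym (if-true (Equivalence.from T-∧ (≤⇒≤ᵇ p , <⇒<ᵇ q))))
      (here (subst (w ⊨_) (take-eq j a r) (⊨-down j w s))))

  advance-⊨ : ∀ j w r → Hit w (advance (down j) j j r) → j ∷ map (punch j) w ⊨ r
  advance-⊨ j w r                  (here p) = skip (⊨-up j w p)
  advance-⊨ j w (letter a l h ∷ r) (there p) with l ≤ᵇ j in eq₁ | j <ᵇ h in eq₂ | p
  ... | true | true | here s =
    take (≤ᵇ⇒≤ l j (subst T (sym eq₁) _)) (<ᵇ⇒< j h (subst T (sym eq₂) _))
      (⊨-up j w (subst (w ⊨_) (sym (take-eq j a r)) s))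

  Hit-step : ∀ j w A → Hit (j ∷ map (punch j) w) A → Hit w (step (down j) j j A)
  Hit-step j w A = Anyₚ.concatMap⁺ _ ∘ Any.map (⊨-advance j w _)

  step-Hit : ∀ j w A → Hit w (step (down j) j j A) → Hit (j ∷ map (punch j) w) A
  step-Hit j w A = Any.map (advance-⊨ j w _) ∘ Anyₚ.concatMap⁻ _

  -- Counting permutations

  word : ∀ {n} → Permutation′ n → List ℕ
  word π = tabulate (toℕ ∘ (π ⟨$⟩ʳ_))

  word-insert : ∀ {n} (j : Fin (suc n)) (π : Permutation′ n) →
                word (insertₚ zero j π) ≡ toℕ j ∷ map (punch (toℕ j)) (word π)
  word-insert j π = cong (toℕ j ∷_) (trans
    (Listₚ.tabulate-cong λ i → trans (cong toℕ (insert-punchIn zero j π i)) (toℕ-punchIn j _))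
    (sym (Listₚ.map-tabulate _ _)))

  ∑< : ℕ → (ℕ → ℕ) → ℕ
  ∑< zero    φ = 0
  ∑< (suc n) φ = φ 0 + ∑< n (φ ∘ suc)

  ∑<-cong : ∀ n {φ χ} → (∀ j → j < n → φ j ≡ χ j) → ∑< n φ ≡ ∑< n χ
  ∑<-cong zero    eq = refl
  ∑<-cong (suc n) eq = cong₂ _+_ (eq 0 z<s) (∑<-cong n λ j j<n → eq (suc j) (s<s j<n))

  ∑<-zero : ∀ n {φ} → (∀ j → j < n → φ j ≡ 0) → ∑< n φ ≡ 0
  ∑<-zero zero    eq = refl
  ∑<-zero (suc n) eq = cong₂ _+_ (eq 0 z<s) (∑<-zero n λ j j<n → eq (suc j) (s<s j<n))

  misses? : ∀ A {n} (π : Permutation′ n) → Dec (¬ Hit (word π) A)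
  misses? A π = ¬? (Any.any? (word π ⊨?_) A)

  number : List Suffix → ℕ → ℕ
  number A n = count (misses? A {n})

  length-filter-map : ∀ {A B : Set} {P : Pred B 0ℓ} (P? : Decidable P) (f : A → B) xs →
                      length (filter P? (map f xs)) ≡ length (filter (P? ∘ f) xs)
  length-filter-map P? f []       = refl
  length-filter-map P? f (x ∷ xs) with does (P? (f x))
  ... | true  = cong suc (length-filter-map P? f xs)
  ... | false = length-filter-map P? f xs

  length-filter-product : ∀ {A B C : Set} {P : Pred C 0ℓ} (P? : Decidable P) (f : A → B → C) xs ys →
    length (filter P? (cartesianProductWith f xs ys)) ≡ sum (map (λ x → length (filter (P? ∘ f x) ys)) xs)
  length-filter-product P? f []       ys = refl
  length-filter-product P? f (x ∷ xs) ys =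
    trans (cong length (Listₚ.filter-++ P? (map (f x) ys) _))
    (trans (Listₚ.length-++ (filter P? (map (f x) ys)))
      (cong₂ _+_ (length-filter-map P? (f x) ys) (length-filter-product P? f xs ys)))

  sum-tabulate : ∀ n {f : Fin n → ℕ} {φ} → (∀ i → f i ≡ φ (toℕ i)) → sum (tabulate f) ≡ ∑< n φ
  sum-tabulate zero    eq = refl
  sum-tabulate (suc n) eq = cong₂ _+_ (eq zero) (sum-tabulate n (eq ∘ suc))

  count-cong : ∀ {n} {P Q : Pred (Permutation′ n) 0ℓ} (P? : Decidable P) (Q? : Decidable Q) →
               (∀ π → P π → Q π) → (∀ π → Q π → P π) → count P? ≡ count Q?
  count-cong {n} P? Q? to from = cong length (Listₚ.filter-≐ P? Q? ((λ {π} → to π) , λ {π} → from π) (permutations n))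

  -- `permutations (suc n)` is built by choosing the first value `j`; the remaining word is
  -- relabelled by `punch j`, which `step` undoes on the suffixes.
  number-suc : ∀ A n → number A (suc n) ≡ ∑< (suc n) (λ j → number (step (down j) j j A) n)
  number-suc A n = trans
    (length-filter-product (misses? A) (insertₚ zero) (allFin (suc n)) (permutations n))
    (trans (cong sum (Listₚ.map-tabulate {n = suc n} id _))
    (sum-tabulate (suc n) {φ = λ j → number (step (down j) j j A) n} λ j →
      count-cong {n} (misses? A ∘ insertₚ zero j) (misses? (step (down (toℕ j)) (toℕ j) (toℕ j) A))
      (λ π ¬p → ¬p ∘ subst (λ w → Hit w A) (sym (word-insert j π)) ∘ step-Hit (toℕ j) (word π) A)
      (λ π ¬p → ¬p ∘ Hit-step (toℕ j) (word π) A ∘ subst (λ w → Hit w A) (word-insert j π))))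

  number-cong : ∀ {A B} n → (∀ (π : Permutation′ n) → Hit (word π) A → Hit (word π) B) →
                (∀ (π : Permutation′ n) → Hit (word π) B → Hit (word π) A) → number A n ≡ number B n
  number-cong {A} {B} n to from = count-cong {n} (misses? A) (misses? B) (λ π → _∘ from π) (λ π → _∘ to π)

  number-zero : ∀ {A} n → (∀ (π : Permutation′ n) → Hit (word π) A) → number A n ≡ 0
  number-zero {A} n all =
    cong length (Listₚ.filter-none (misses? A) (All.universal (λ π ¬p → ¬p (all π)) (permutations n)))

  length-filter-mono : ∀ {A : Set} {P Q : Pred A 0ℓ} (P? : Decidable P) (Q? : Decidable Q) → (∀ x → P x → Q x) →
                       ∀ xs → length (filter P? xs) ≤ length (filter Q? xs)
  length-filter-mono P? Q? P⊆Q []       = z≤n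
  length-filter-mono P? Q? P⊆Q (x ∷ xs) with P? x | Q? x
  ... | yes _ | yes _ = s≤s (length-filter-mono P? Q? P⊆Q xs)
  ... | yes p | no ¬q with () ← ¬q (P⊆Q x p)
  ... | no _  | yes _ = m≤n⇒m≤1+n (length-filter-mono P? Q? P⊆Q xs)
  ... | no _  | no _  = length-filter-mono P? Q? P⊆Q xs

  number-mono : ∀ {A B} n → (∀ (π : Permutation′ n) → Hit (word π) A → Hit (word π) B) → number B n ≤ number A n
  number-mono {A} {B} n sub = length-filter-mono (misses? B) (misses? A) (λ π → _∘ sub π) (permutations n)

  -- Sums over slot sizes

  -- Sums over a + b = n: over all such pairs and over those with a positive.
  ∑+ ∑⁺ : ℕ → (ℕ → ℕ → ℕ) → ℕ
  ∑+ zero    f = f 0 0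
  ∑+ (suc n) f = f 0 (suc n) + ∑+ n (f ∘ suc)
  ∑⁺ zero    f = 0
  ∑⁺ (suc n) f = ∑+ n (f ∘ suc)

  -- Sum over the compositions of n into s positive parts.
  ∑ᶜ : ℕ → ℕ → (List ℕ → ℕ) → ℕ
  ∑ᶜ zero    zero    h = h []
  ∑ᶜ zero    (suc n) h = 0
  ∑ᶜ (suc s) n       h = ∑⁺ n λ x m → ∑ᶜ s m (h ∘ (x ∷_))

  ∑+-cong : ∀ n {f g} → (∀ a b → a + b ≡ n → f a b ≡ g a b) → ∑+ n f ≡ ∑+ n g
  ∑+-cong zero    eq = eq 0 0 refl
  ∑+-cong (suc n) eq = cong₂ _+_ (eq 0 (suc n) refl) (∑+-cong n λ a b p → eq (suc a) b (cong suc p))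

  ∑⁺-cong : ∀ n {f g} → (∀ a b → suc a + b ≡ n → f (suc a) b ≡ g (suc a) b) → ∑⁺ n f ≡ ∑⁺ n g
  ∑⁺-cong zero    eq = refl
  ∑⁺-cong (suc n) eq = ∑+-cong n λ a b p → eq a b (cong suc p)

  ∑+-add : ∀ n f g → ∑+ n (λ a b → f a b + g a b) ≡ ∑+ n f + ∑+ n g
  ∑+-add zero    f g = refl
  ∑+-add (suc n) f g = trans (cong (f 0 (suc n) + g 0 (suc n) +_) (∑+-add n (f ∘ suc) (g ∘ suc)))
    (interchange (f 0 (suc n)) (g 0 (suc n)) (∑+ n (f ∘ suc)) (∑+ n (g ∘ suc)))

  ∑⁺-add : ∀ n f g → ∑⁺ n (λ a b → f a b + g a b) ≡ ∑⁺ n f + ∑⁺ n g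
  ∑⁺-add zero    f g = refl
  ∑⁺-add (suc n) f g = ∑+-add n _ _

  ∑+-head : ∀ n f → ∑+ n f ≡ f 0 n + ∑⁺ n f
  ∑+-head zero    f = sym (+-identityʳ _)
  ∑+-head (suc n) f = refl

  -- The last pair, with second entry 0, contributes nothing. Dropping it lowers the total, so that
  -- an induction hypothesis about a positive remainder `suc m` applies to every other pair.
  ∑+-pad : ∀ n {f} → (∀ x → f x 0 ≡ 0) → ∑+ (suc n) f ≡ ∑+ n (λ x m → f x (suc m))
  ∑+-pad zero    {f} eq = trans (cong (f 0 1 +_) (eq 1)) (+-identityʳ _)
  ∑+-pad (suc n) {f} eq = cong (f 0 (2+ n) +_) (∑+-pad n {f ∘ suc} (eq ∘ suc))

  ∑+-assoc : ∀ n (f : ℕ → ℕ → ℕ → ℕ) →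
             ∑+ n (λ x c → ∑+ x (λ a b → f a b c)) ≡ ∑+ n (λ a y → ∑+ y (f a))
  ∑+-assoc zero    f = refl
  ∑+-assoc (suc n) f = begin
    f 0 0 (suc n) + ∑+ n (λ x c → f 0 (suc x) c + ∑+ x (λ a b → f (suc a) b c))
      ≡⟨ cong (f 0 0 (suc n) +_) (∑+-add n (λ x c → f 0 (suc x) c) _) ⟩
    f 0 0 (suc n) + (∑+ n (λ x c → f 0 (suc x) c) + ∑+ n (λ x c → ∑+ x (λ a b → f (suc a) b c)))
      ≡⟨ sym (+-assoc (f 0 0 (suc n)) _ _) ⟩
    ∑+ (suc n) (f 0) + ∑+ n (λ x c → ∑+ x (λ a b → f (suc a) b c))
      ≡⟨ cong (∑+ (suc n) (f 0) +_) (∑+-assoc n (f ∘ suc)) ⟩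
    ∑+ (suc n) (f 0) + ∑+ n (λ a y → ∑+ y (f (suc a))) ∎

  ∑ᶜ-cong : ∀ s n {h k} → (∀ g → length g ≡ s → All (0 <_) g → sum g ≡ n → h g ≡ k g) → ∑ᶜ s n h ≡ ∑ᶜ s n k
  ∑ᶜ-cong zero    zero    eq = eq [] refl [] refl
  ∑ᶜ-cong zero    (suc n) eq = refl
  ∑ᶜ-cong (suc s) n       eq = ∑⁺-cong n λ x m p → ∑ᶜ-cong s m λ g len pos tot →
    eq (suc x ∷ g) (cong suc len) (z<s ∷ pos) (trans (cong (suc x +_) tot) p)

  ∑ᶜ-add : ∀ s n h k → ∑ᶜ s n (λ g → h g + k g) ≡ ∑ᶜ s n h + ∑ᶜ s n k
  ∑ᶜ-add zero    zero    h k = refl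
  ∑ᶜ-add zero    (suc n) h k = refl
  ∑ᶜ-add (suc s) n       h k = trans (∑⁺-cong n λ x m _ → ∑ᶜ-add s m _ _) (∑⁺-add n _ _)

  ∑ᶜ-zero : ∀ s n → ∑ᶜ s n (λ _ → 0) ≡ 0
  ∑ᶜ-zero zero    zero    = refl
  ∑ᶜ-zero zero    (suc n) = refl
  ∑ᶜ-zero (suc s) zero    = refl
  ∑ᶜ-zero (suc s) (suc n) = trans (∑+-cong n λ x m _ → ∑ᶜ-zero s m) (lemma n)
    where
    lemma : ∀ n → ∑+ n (λ _ _ → 0) ≡ 0
    lemma zero    = refl
    lemma (suc n) = lemma n

  ∑ᶜ-∑+ : ∀ s n x (h : ℕ → ℕ → List ℕ → ℕ) →
          ∑ᶜ s n (λ g → ∑+ x (λ a b → h a b g)) ≡ ∑+ x (λ a b → ∑ᶜ s n (h a b))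
  ∑ᶜ-∑+ s n zero    h = refl
  ∑ᶜ-∑+ s n (suc x) h = trans (∑ᶜ-add s n _ _) (cong (∑ᶜ s n (h 0 (suc x)) +_) (∑ᶜ-∑+ s n x (h ∘ suc)))

  ∑ᶜ-∑< : ∀ s n k (h : ℕ → List ℕ → ℕ) → ∑ᶜ s n (λ g → ∑< k (λ i → h i g)) ≡ ∑< k (λ i → ∑ᶜ s n (h i))
  ∑ᶜ-∑< s n zero    h = ∑ᶜ-zero s n
  ∑ᶜ-∑< s n (suc k) h = trans (∑ᶜ-add s n _ _) (cong (_ +_) (∑ᶜ-∑< s n k (h ∘ suc)))

  -- Sum over the ways to remove one value from slot i of a list of slot sizes; the slot becomes two slots,
  -- possibly of size 0.
  splits : ℕ → List ℕ → (List ℕ → ℕ) → ℕ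
  splits _       []          ψ = 0
  splits zero    (zero  ∷ g) ψ = 0
  splits zero    (suc x ∷ g) ψ = ∑+ x λ a b → ψ (a ∷ b ∷ g)
  splits (suc i) (x     ∷ g) ψ = splits i g (ψ ∘ (x ∷_))

  -- An empty slot is inserted at position `i`, to describe the list of slots before its empty parts
  -- are discarded.
  void : ℕ → List ℕ → List ℕ
  void zero    g       = 0 ∷ g
  void (suc i) []      = 0 ∷ []
  void (suc i) (x ∷ g) = x ∷ void i g

  -- The four terms collect the cases where both, the left, the right, or none of the two new slots is empty.
  ∑ᶜ-splits : ∀ i s n ψ → i < s → ∑ᶜ s (suc n) (λ g → splits i g ψ) ≡
    ∑ᶜ (pred s) n (ψ ∘ void i ∘ void i) + (∑ᶜ s n (ψ ∘ void i) + (∑ᶜ s n (ψ ∘ void (suc i)) + ∑ᶜ (suc s) n ψ))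
  ∑ᶜ-splits zero (suc s) n ψ _ = begin
    ∑+ n (λ x m → ∑ᶜ s m (λ g → ∑+ x (λ a b → ψ (a ∷ b ∷ g))))
      ≡⟨ ∑+-cong n (λ x m _ → ∑ᶜ-∑+ s m x (λ a b g → ψ (a ∷ b ∷ g))) ⟩
    ∑+ n (λ x m → ∑+ x (λ a b → f a b m))
      ≡⟨ ∑+-assoc n f ⟩
    ∑+ n (λ a y → ∑+ y (f a))
      ≡⟨ ∑+-head n (λ a y → ∑+ y (f a)) ⟩
    ∑+ n (f 0) + ∑⁺ n (λ a y → ∑+ y (f a))
      ≡⟨ cong₂ _+_ (∑+-head n (f 0)) (∑⁺-cong n λ a y _ → ∑+-head y (f (suc a))) ⟩
    (f 0 0 n + ∑⁺ n (f 0)) + ∑⁺ n (λ a y → f a 0 y + ∑⁺ y (f a))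
      ≡⟨ cong (f 0 0 n + ∑⁺ n (f 0) +_) (∑⁺-add n (λ a → f a 0) (λ a y → ∑⁺ y (f a))) ⟩
    (f 0 0 n + ∑⁺ n (f 0)) + (∑⁺ n (λ a → f a 0) + ∑⁺ n (λ a y → ∑⁺ y (f a)))
      ≡⟨ +-assoc (f 0 0 n) _ _ ⟩
    f 0 0 n + (∑⁺ n (f 0) + (∑⁺ n (λ a → f a 0) + ∑⁺ n (λ a y → ∑⁺ y (f a)))) ∎
    where
    f : ℕ → ℕ → ℕ → ℕ
    f a b m = ∑ᶜ s m (λ g → ψ (a ∷ b ∷ g))
  ∑ᶜ-splits (suc i) (suc zero)    zero    ψ (s≤s ())
  ∑ᶜ-splits (suc i) (suc (suc s)) zero    ψ _ = refl
  ∑ᶜ-splits (suc i) (suc (suc s)) (suc n) ψ (s≤s i<s) = begin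
    ∑+ (suc n) (λ x m → ∑ᶜ (suc s) m (λ g → splits i g (ψ ∘ (suc x ∷_))))
      ≡⟨ ∑+-pad n {λ x m → ∑ᶜ (suc s) m (λ g → splits i g (ψ ∘ (suc x ∷_)))} (λ x → refl) ⟩
    ∑+ n (λ x m → ∑ᶜ (suc s) (suc m) (λ g → splits i g (ψ ∘ (suc x ∷_))))
      ≡⟨ ∑+-cong n (λ x m _ → ∑ᶜ-splits i (suc s) m (ψ ∘ (suc x ∷_)) i<s) ⟩
    ∑+ n (λ x m → F x m + (L x m + (R x m + M x m)))
      ≡⟨ ∑+-add n F _ ⟩
    ∑+ n F + ∑+ n (λ x m → L x m + (R x m + M x m))
      ≡⟨ cong (∑+ n F +_) (∑+-add n L _) ⟩
    ∑+ n F + (∑+ n L + ∑+ n (λ x m → R x m + M x m))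
      ≡⟨ cong (λ z → ∑+ n F + (∑+ n L + z)) (∑+-add n R M) ⟩
    ∑+ n F + (∑+ n L + (∑+ n R + ∑+ n M)) ∎
    where
    F L R M : ℕ → ℕ → ℕ
    F x m = ∑ᶜ s m (ψ ∘ (suc x ∷_) ∘ void i ∘ void i)
    L x m = ∑ᶜ (suc s) m (ψ ∘ (suc x ∷_) ∘ void i)
    R x m = ∑ᶜ (suc s) m (ψ ∘ (suc x ∷_) ∘ void (suc i))
    M x m = ∑ᶜ (suc (suc s)) m (ψ ∘ (suc x ∷_))

  ∑<-+ : ∀ m n φ → ∑< (m + n) φ ≡ ∑< m φ + ∑< n (φ ∘ (m +_))
  ∑<-+ zero    n φ = refl
  ∑<-+ (suc m) n φ = trans (cong (φ 0 +_) (∑<-+ m n (φ ∘ suc))) (sym (+-assoc (φ 0) _ _))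

  ∑<-∑+ : ∀ n {φ f} → (∀ a b → a + b ≡ n → φ a ≡ f a b) → ∑< (suc n) φ ≡ ∑+ n f
  ∑<-∑+ zero    eq = trans (+-identityʳ _) (eq 0 0 refl)
  ∑<-∑+ (suc n) eq = cong₂ _+_ (eq 0 (suc n) refl) (∑<-∑+ n λ a b p → eq (suc a) b (cong suc p))

  -- A value is determined by its slot and the number `a` of values below it in that slot; its rank
  -- is then `sum g₁ + a`, and `b` values of the slot lie above it.
  ∑<-splits : ∀ g φ (ψ : ℕ → List ℕ → ℕ) →
    (∀ g₁ a b g₂ → g ≡ g₁ ++ suc (a + b) ∷ g₂ → φ (sum g₁ + a) ≡ ψ (length g₁) (g₁ ++ a ∷ b ∷ g₂)) →
    ∑< (sum g) φ ≡ ∑< (length g) (λ i → splits i g (ψ i))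
  ∑<-splits []      φ ψ eq = refl
  ∑<-splits (x ∷ g) φ ψ eq = trans (∑<-+ x (sum g) φ) (cong₂ _+_ (head x eq)
    (∑<-splits g (φ ∘ (x +_)) (λ i → ψ (suc i) ∘ (x ∷_)) λ g₁ a b g₂ p →
      trans (cong φ (sym (+-assoc x (sum g₁) a))) (eq (x ∷ g₁) a b g₂ (cong (x ∷_) p))))
    where
    head : ∀ x → (∀ g₁ a b g₂ → x ∷ g ≡ g₁ ++ suc (a + b) ∷ g₂ →
           φ (sum g₁ + a) ≡ ψ (length g₁) (g₁ ++ a ∷ b ∷ g₂)) → ∑< x φ ≡ splits 0 (x ∷ g) (ψ 0)
    head zero    eq = refl
    head (suc x) eq = ∑<-∑+ x λ a b p → eq [] a b g (cong (λ y → suc y ∷ g) (sym p))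

  -- From states to values

  prefix : List ℕ → ℕ → ℕ
  prefix g       zero    = 0
  prefix []      (suc k) = 0
  prefix (x ∷ g) (suc k) = x + prefix g k

  prefix-mono : ∀ g → Monotone (prefix g)
  prefix-mono g       z≤n     = z≤n
  prefix-mono []      (s≤s p) = z≤n
  prefix-mono (x ∷ g) (s≤s p) = +-monoʳ-≤ x (prefix-mono g p)

  inst : List ℕ → List Suffix → List Suffix
  inst g = map (map (shift (prefix g)))

  map-shift-∘ : ∀ {σ τ ρ} → (∀ k → σ (τ k) ≡ ρ k) → ∀ r → map (shift σ) (map (shift τ) r) ≡ map (shift ρ) r
  map-shift-∘ eq r = trans (sym (Listₚ.map-∘ r))
    (Listₚ.map-cong (λ { (letter a l h) → cong₂ (letter a) (eq l) (eq h) }) r)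

  T-ext : ∀ {x y} → (T x → T y) → (T y → T x) → x ≡ y
  T-ext {true}  {true}  f g = refl
  T-ext {true}  {false} f g with () ← f _
  T-ext {false} {true}  f g with () ← g _
  T-ext {false} {false} f g = refl

  -- `γ` and `γ′` translate cuts into values before and after value `j` of slot `i` is played, and
  -- `σ` renumbers the cuts. The last two hypotheses place `j` in slot `i`, so the test made in
  -- `use` has the same result for slots as for values.
  module _ {γ γ′ σ : ℕ → ℕ} {i j c : ℕ} (γ′-mono : Monotone γ′) (cut : γ′ c ≡ j)
           (compat : ∀ k → down j (γ k) ≡ γ′ (σ k))
           (≤-to : ∀ l → l ≤ i → γ l ≤ j) (<-to : ∀ h → i < h → j < γ h) where

    private
      low : ∀ l → (γ l ≤ᵇ j) ≡ (l ≤ᵇ i)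
      low l = T-ext {γ l ≤ᵇ j} {l ≤ᵇ i}
        (λ p → ≤⇒≤ᵇ (≮⇒≥ λ i<l → <⇒≱ (<-to l i<l) (≤ᵇ⇒≤ (γ l) j p)))
        (λ p → ≤⇒≤ᵇ (≤-to l (≤ᵇ⇒≤ l i p)))

      high : ∀ h → (j <ᵇ γ h) ≡ (i <ᵇ h)
      high h = T-ext {j <ᵇ γ h} {i <ᵇ h}
        (λ p → <⇒<ᵇ (≰⇒> λ h≤i → <⇒≱ (<ᵇ⇒< j (γ h) p) (≤-to h h≤i)))
        (λ p → <⇒<ᵇ (<-to h (<ᵇ⇒< i h p)))

      moved : ∀ e → shift (down j) (shift γ e) ≡ shift γ′ (shift σ e)
      moved (letter a l h) = cong₂ (letter a) (compat l) (compat h)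

      refined : ∀ a e → refine a j j (shift (down j) (shift γ e)) ≡ shift γ′ (refine a c c (shift σ e))
      refined a e = trans (cong (refine a j j) (moved e))
        (sym (trans (shift-refine γ′-mono a c c (shift σ e)) (cong (λ d → refine a d d (shift γ′ (shift σ e))) cut)))

    advance-inst : ∀ r → advance (down j) j j (map (shift γ) r) ≡ map (map (shift γ′)) (advance σ i c r)
    advance-inst r = cong₂ _∷_ (trans (sym (Listₚ.map-∘ r)) (trans (Listₚ.map-cong moved r) (Listₚ.map-∘ r))) (used r)
      where
      used : ∀ r → use (down j) j j (map (shift γ) r) ≡ map (map (shift γ′)) (use σ i c r)
      used [] = refl
      used (letter a l h ∷ r) = trans
        (cong (λ b → if b then map (refine a j j ∘ shift (down j)) (map (shift γ) r) ∷ [] else [])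
          (cong₂ _∧_ (low l) (high h)))
        (chosen ((l ≤ᵇ i) ∧ (i <ᵇ h)))
        where
        chosen : ∀ b → (if b then map (refine a j j ∘ shift (down j)) (map (shift γ) r) ∷ [] else []) ≡
                       map (map (shift γ′)) (if b then map (refine a c c ∘ shift σ) r ∷ [] else [])
        chosen false = refl
        chosen true  = cong (_∷ [])
          (trans (sym (Listₚ.map-∘ r)) (trans (Listₚ.map-cong (refined a) r) (Listₚ.map-∘ r)))

    step-inst : ∀ A → step (down j) j j (map (map (shift γ)) A) ≡ map (map (shift γ′)) (step σ i c A)
    step-inst A = trans (Listₚ.concatMap-map (advance (down j) j j) (map (shift γ)) A)
      (trans (Listₚ.concatMap-cong advance-inst A) (sym (Listₚ.map-concatMap _ (advance σ i c) A)))

  step-shift : ∀ {τ σ σ′ : ℕ → ℕ} {i c c′} → Monotone τ → (∀ k → τ (σ k) ≡ σ′ k) → τ c ≡ c′ → ∀ A →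
               map (map (shift τ)) (step σ i c A) ≡ step σ′ i c′ A
  step-shift {τ} {σ} {σ′} {i} {c} {c′} mono eq refl A =
    trans (Listₚ.map-concatMap _ (advance σ i c) A)
      (Listₚ.concatMap-cong (λ r → cong₂ _∷_ (map-shift-∘ eq r) (used r)) A)
    where
    refined : ∀ a e → shift τ (refine a c c (shift σ e)) ≡ refine a c′ c′ (shift σ′ e)
    refined a (letter b l h) = trans (shift-refine mono a c c (shift σ (letter b l h)))
      (cong (refine a c′ c′) (cong₂ (letter b) (eq l) (eq h)))
    used : ∀ r → map (map (shift τ)) (use σ i c r) ≡ use σ′ i c′ r
    used [] = refl
    used (letter a l h ∷ r) with (l ≤ᵇ i) ∧ (i <ᵇ h)
    ... | false = refl
    ... | true  = cong (_∷ []) (trans (sym (Listₚ.map-∘ r)) (Listₚ.map-cong (refined a) r))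

  down-+ : ∀ x j k → down (x + j) (x + k) ≡ x + down j k
  down-+ zero    j k = refl
  down-+ (suc x) j k = cong suc (down-+ x j k)

  down-zero : ∀ j → down j 0 ≡ 0
  down-zero zero    = refl
  down-zero (suc j) = refl

  down-suc-+ : ∀ a b → down a (suc (a + b)) ≡ a + b
  down-suc-+ zero    b = refl
  down-suc-+ (suc a) b = cong suc (down-suc-+ a b)

  up-zero : ∀ i → up i 0 ≡ 0
  up-zero zero    = refl
  up-zero (suc i) = refl

  module _ (a b : ℕ) (g₂ : List ℕ) where

    prefix-cut : ∀ g₁ → prefix (g₁ ++ a ∷ b ∷ g₂) (suc (length g₁)) ≡ sum g₁ + a
    prefix-cut []       = +-identityʳ a
    prefix-cut (x ∷ g₁) = trans (cong (x +_) (prefix-cut g₁)) (sym (+-assoc x (sum g₁) a))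

    prefix-down : ∀ g₁ k → down (sum g₁ + a) (prefix (g₁ ++ suc (a + b) ∷ g₂) k) ≡
                           prefix (g₁ ++ a ∷ b ∷ g₂) (up (length g₁) k)
    prefix-down g₁       zero    rewrite up-zero (length g₁) = down-zero (sum g₁ + a)
    prefix-down []       (suc k) = trans (cong (down a ∘ suc) (+-assoc a b (prefix g₂ k)))
                                         (down-suc-+ a (b + prefix g₂ k))
    prefix-down (x ∷ g₁) (suc k) rewrite +-assoc x (sum g₁) a =
      trans (down-+ x (sum g₁ + a) _) (cong (x +_) (prefix-down g₁ k))

    prefix-≤ : ∀ g₁ l → l ≤ length g₁ → prefix (g₁ ++ suc (a + b) ∷ g₂) l ≤ sum g₁ + a
    prefix-≤ g₁       zero    p       = z≤n
    prefix-≤ (x ∷ g₁) (suc l) (s≤s p) =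
      ≤-trans (+-monoʳ-≤ x (prefix-≤ g₁ l p)) (≤-reflexive (sym (+-assoc x (sum g₁) a)))

    prefix-> : ∀ g₁ h → length g₁ < h → sum g₁ + a < prefix (g₁ ++ suc (a + b) ∷ g₂) h
    prefix-> []       (suc h) p       = s≤s (≤-trans (m≤m+n a b) (m≤m+n (a + b) _))
    prefix-> (x ∷ g₁) (suc h) (s≤s p) =
      ≤-trans (≤-reflexive (trans (cong suc (+-assoc x (sum g₁) a)) (sym (+-suc x _))))
        (+-monoʳ-≤ x (prefix-> g₁ h p))

    -- With sizes `a` and `b` allowed to be 0, the move `middle` describes every position in the
    -- slot. The other three moves arise from it by discarding empty slots.
    step-middle : ∀ g₁ A → let j = sum g₁ + a in
      step (down j) j j (inst (g₁ ++ suc (a + b) ∷ g₂) A) ≡ inst (g₁ ++ a ∷ b ∷ g₂) (middle (length g₁) A)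
    step-middle g₁ = step-inst (prefix-mono _) (prefix-cut g₁) (prefix-down g₁) (prefix-≤ g₁) (prefix-> g₁)

  down-up : ∀ i k → down i (up i k) ≡ k
  down-up zero    zero    = refl
  down-up zero    (suc k) = refl
  down-up (suc i) zero    = refl
  down-up (suc i) (suc k) = cong suc (down-up i k)

  down-suc-up : ∀ i k → down (suc i) (up i k) ≡ k
  down-suc-up zero    zero    = refl
  down-suc-up zero    (suc k) = refl
  down-suc-up (suc i) zero    = refl
  down-suc-up (suc i) (suc k) = cong suc (down-suc-up i k)

  -- The two cuts around an empty slot stand for the same value and may be merged. Hence a
  -- zero-sized part is removed by composing with `down`: at `i` for the left part, at `suc i` for
  -- the right one.
  prefix-void : ∀ i g → i ≤ length g → ∀ k → prefix (void i g) k ≡ prefix g (down i k)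
  prefix-void zero    g       p       zero    = refl
  prefix-void zero    g       p       (suc k) = refl
  prefix-void (suc i) (x ∷ g) p       zero    = refl
  prefix-void (suc i) (x ∷ g) (s≤s p) (suc k) = cong (x +_) (prefix-void i g p k)

  inst-void : ∀ i g → i ≤ length g → ∀ A → inst (void i g) A ≡ inst g (map (map (shift (down i))) A)
  inst-void i g p A =
    trans (Listₚ.map-cong (λ r → sym (map-shift-∘ (λ k → sym (prefix-void i g p k)) r)) A) (Listₚ.map-∘ A)

  length-void : ∀ i g → i ≤ length g → length (void i g) ≡ suc (length g)
  length-void zero    g       p       = refl
  length-void (suc i) (x ∷ g) (s≤s p) = cong suc (length-void i g p)

  middle-left : ∀ i A → map (map (shift (down i))) (middle i A) ≡ left i A
  middle-left i = step-shift (down-mono i) (down-up i) (down-suc-self i)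

  inst-left : ∀ i g → i ≤ length g → ∀ A → inst (void i g) (middle i A) ≡ inst g (left i A)
  inst-left i g p A = trans (inst-void i g p (middle i A)) (cong (inst g) (middle-left i A))

  inst-right : ∀ i g → suc i ≤ length g → ∀ A → inst (void (suc i) g) (middle i A) ≡ inst g (right i A)
  inst-right i g p A = trans (inst-void (suc i) g p (middle i A))
    (cong (inst g) (step-shift (down-mono (suc i)) (down-suc-up i) (down-self (suc i)) A))

  inst-fill : ∀ i g → i ≤ length g → ∀ A → inst (void i (void i g)) (middle i A) ≡ inst g (fill i A)
  inst-fill i g p A = trans
    (inst-left i (void i g) (≤-trans p (≤-trans (n≤1+n _) (≤-reflexive (sym (length-void i g p))))) A)
    (trans (inst-void i g p _) (cong (inst g) (step-shift (down-mono i) (λ k → refl) (down-self i) A)))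

  -- All slot sizes compatible with a state are summed over: the sizes cannot be recovered from the state.
  completions : State → ℕ → ℕ
  completions (s , A) n = ∑ᶜ s n λ g → number (inst g A) n

  sum-map-concat : ∀ {A : Set} (f : A → ℕ) (h : ℕ → List A) s →
                   sum (map f (concat (applyUpTo h s))) ≡ ∑< s (λ i → sum (map f (h i)))
  sum-map-concat f h zero    = refl
  sum-map-concat f h (suc s) =
    trans (cong sum (Listₚ.map-++ f (h 0) _))
    (trans (sum-++ (map f (h 0)) _) (cong (sum (map f (h 0)) +_) (sum-map-concat f (h ∘ suc) s)))

  completions-suc : ∀ q n → completions q (suc n) ≡ sum (map (λ q′ → completions q′ n) (moves q))
  completions-suc (s , A) n = begin
    ∑ᶜ s (suc n) (λ g → number (inst g A) (suc n))
      ≡⟨ ∑ᶜ-cong s (suc n) split ⟩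
    ∑ᶜ s (suc n) (λ g → ∑< s (λ i → splits i g (ψ i)))
      ≡⟨ ∑ᶜ-∑< s (suc n) s (λ i g → splits i g (ψ i)) ⟩
    ∑< s (λ i → ∑ᶜ s (suc n) (λ g → splits i g (ψ i)))
      ≡⟨ ∑<-cong s slot ⟩
    ∑< s (λ i → sum (map (λ q → completions q n) (movesAt s A i)))
      ≡⟨ sym (sum-map-concat (λ q → completions q n) (movesAt s A) s) ⟩
    sum (map (λ q → completions q n) (moves (s , A))) ∎
    where
    ψ : ℕ → List ℕ → ℕ
    ψ i g = number (inst g (middle i A)) n

    split : ∀ g → length g ≡ s → All (0 <_) g → sum g ≡ suc n →
            number (inst g A) (suc n) ≡ ∑< s (λ i → splits i g (ψ i))
    split g refl _ tot = begin
      number (inst g A) (suc n)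
        ≡⟨ number-suc (inst g A) n ⟩
      ∑< (suc n) φ
        ≡⟨ cong (λ m → ∑< m φ) (sym tot) ⟩
      ∑< (sum g) φ
        ≡⟨ ∑<-splits g φ ψ (λ { g₁ a b g₂ refl → cong (λ B → number B n) (step-middle a b g₂ g₁ A) }) ⟩
      ∑< (length g) (λ i → splits i g (ψ i)) ∎
      where
      φ : ℕ → ℕ
      φ j = number (step (down j) j j (inst g A)) n

    slot : ∀ i → i < s → ∑ᶜ s (suc n) (λ g → splits i g (ψ i)) ≡ sum (map (λ q → completions q n) (movesAt s A i))
    slot i i<s = trans (∑ᶜ-splits i s n (ψ i) i<s) (cong₂ _+_
      (∑ᶜ-cong (pred s) n λ g len _ _ → cong (λ B → number B n)
        (inst-fill i g (≤-trans (<⇒≤pred i<s) (≤-reflexive (sym len))) A))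
      (cong₂ _+_ (∑ᶜ-cong s n λ g len _ _ → cong (λ B → number B n)
        (inst-left i g (≤-trans (<⇒≤ i<s) (≤-reflexive (sym len))) A))
      (cong₂ _+_ (∑ᶜ-cong s n λ g len _ _ → cong (λ B → number B n)
        (inst-right i g (≤-trans i<s (≤-reflexive (sym len))) A))
        (sym (+-identityʳ _)))))

  -- Redundant suffixes

  Consistent : ℕ → ℕ → ℕ × ℕ → Set
  Consistent a b (c , d) = (d < b → c < a) × (b < d → a < c)

  data Embeds (P : List (ℕ × ℕ)) : Suffix → Suffix → Set where
    nil  : ∀ {e} → Embeds P e []
    drop : ∀ {x e f} → Embeds P e f → Embeds P (x ∷ e) f
    keep : ∀ {a l h b l′ h′ e f} → l′ ≤ l → h ≤ h′ → All (Consistent a b) P →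
           Embeds ((a , b) ∷ P) e f → Embeds P (letter a l h ∷ e) (letter b l′ h′ ∷ f)

  ∧⁻ : ∀ x {y} → T (x ∧ y) → T x × T y
  ∧⁻ x = Equivalence.to (T-∧ {x})

  ∨⁻ : ∀ x {y} → T (x ∨ y) → T x ⊎ T y
  ∨⁻ x = Equivalence.to (T-∨ {x})

  comparison-sound : ∀ a b c d → T (if d <ᵇ b then c <ᵇ a else if b <ᵇ d then a <ᵇ c else true) →
                     Consistent a b (c , d)
  comparison-sound a b c d q with d <ᵇ b in eq₁ | b <ᵇ d in eq₂
  ... | true  | _     = (λ _ → <ᵇ⇒< c a q) , λ b<d → ⊥-elim (<-asym b<d (<ᵇ⇒< d b (subst T (sym eq₁) _)))
  ... | false | true  = (λ d<b → ⊥-elim (subst T eq₁ (<⇒<ᵇ d<b))) , λ _ → <ᵇ⇒< a c q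
  ... | false | false = (λ d<b → ⊥-elim (subst T eq₁ (<⇒<ᵇ d<b))) , λ b<d → ⊥-elim (subst T eq₂ (<⇒<ᵇ b<d))

  consistent-sound : ∀ a b P → T (consistent a b P) → All (Consistent a b) P
  consistent-sound a b []            _ = []
  consistent-sound a b ((c , d) ∷ P) p with ∧⁻ (if d <ᵇ b then c <ᵇ a else if b <ᵇ d then a <ᵇ c else true) p
  ... | q , r = comparison-sound a b c d q ∷ consistent-sound a b P r

  embeds-sound : ∀ P k e f → T (embeds P k e f) → Embeds P e f
  drops-sound  : ∀ P k e f → T (drops P k e f) → Embeds P e f
  embeds-sound P k []      []      _ = nil
  embeds-sound P k (x ∷ e) []      _ = nil
  embeds-sound P k (letter a l h ∷ e) (letter b l′ h′ ∷ f) p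
    with ∨⁻ ((l′ ≤ᵇ l) ∧ (h ≤ᵇ h′) ∧ consistent a b P ∧ embeds ((a , b) ∷ P) k e f) p
  ... | inj₂ q = drop (drops-sound P k e _ q)
  ... | inj₁ q with ∧⁻ (l′ ≤ᵇ l) q
  ...   | q₁ , r with ∧⁻ (h ≤ᵇ h′) r
  ...     | q₂ , s with ∧⁻ (consistent a b P) s
  ...       | q₃ , q₄ = keep (≤ᵇ⇒≤ l′ l q₁) (≤ᵇ⇒≤ h h′ q₂) (consistent-sound a b P q₃) (embeds-sound _ k e f q₄)
  drops-sound P (suc k) e f p = embeds-sound P k e f p

  Embeds-shift : ∀ {γ : ℕ → ℕ} {P e f} → Monotone γ → Embeds P e f → Embeds P (map (shift γ) e) (map (shift γ) f)
  Embeds-shift mono nil            = nil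
  Embeds-shift mono (drop E)       = drop (Embeds-shift mono E)
  Embeds-shift mono (keep p q c E) = keep (mono p) (mono q) c (Embeds-shift mono E)

  raise-≤ : ∀ {l l′} b b′ x → (T b′ → T b) → l′ ≤ l → (if b′ then l′ ⊔ x else l′) ≤ (if b then l ⊔ x else l)
  raise-≤ true  true  x imp p = ⊔-monoˡ-≤ x p
  raise-≤ true  false x imp p = ≤-trans p (m≤m⊔n _ x)
  raise-≤ false true  x imp p = ⊥-elim (imp _)
  raise-≤ false false x imp p = p

  lower-≤ : ∀ {h h′} b b′ x → (T b′ → T b) → h ≤ h′ → (if b then h ⊓ x else h) ≤ (if b′ then h′ ⊓ x else h′)
  lower-≤ true  true  x imp p = ⊓-monoˡ-≤ x p
  lower-≤ true  false x imp p = ≤-trans (m⊓n≤m _ x) p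
  lower-≤ false true  x imp p = ⊥-elim (imp _)
  lower-≤ false false x imp p = p

  -- As the pair just played is recorded in `P`, each bound it imposes on a letter of `f` is also
  -- imposed on the matching letter of `e`.
  Embeds-refine : ∀ {P e f c d x y} → (c , d) ∈ P → Embeds P e f →
                  Embeds P (map (refine c x y) e) (map (refine d x y) f)
  Embeds-refine i nil      = nil
  Embeds-refine i (drop E) = drop (Embeds-refine i E)
  Embeds-refine {c = c} {d} {x} {y} i (keep {a} {_} {_} {b} p q cs E) = keep
    (raise-≤ (c <ᵇ a) (d <ᵇ b) x (λ t → <⇒<ᵇ (proj₁ (All.lookup cs i) (<ᵇ⇒< d b t))) p)
    (lower-≤ (a <ᵇ c) (b <ᵇ d) y (λ t → <⇒<ᵇ (proj₂ (All.lookup cs i) (<ᵇ⇒< b d t))) q)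
    cs (Embeds-refine (there i) E)

  -- A letter played in `e` but dropped for `f` only narrows the bounds in `e`, and narrower bounds
  -- on that side preserve an embedding.
  Embeds-narrow : ∀ {P e f} c x y → Embeds P e f → Embeds P (map (refine c x y) e) f
  Embeds-narrow c x y nil      = nil
  Embeds-narrow c x y (drop E) = drop (Embeds-narrow c x y E)
  Embeds-narrow c x y (keep {a} p q cs E) =
    keep (raise-≤ (c <ᵇ a) false x (λ ()) p) (lower-≤ (a <ᵇ c) false y (λ ()) q) cs (Embeds-narrow c x y E)

  ⊨-embeds : ∀ {w P e f} → Embeds P e f → w ⊨ e → w ⊨ f
  ⊨-embeds nil             _            = done
  ⊨-embeds E@(drop _)      (skip p)     = skip (⊨-embeds E p)
  ⊨-embeds E@(keep _ _ _ _) (skip p)    = skip (⊨-embeds E p)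
  ⊨-embeds (drop E)        (take p q s) = skip (⊨-embeds (Embeds-narrow _ _ _ E) s)
  ⊨-embeds (keep u v _ E)  (take p q s) = take (≤-trans u p) (≤-trans q v) (⊨-embeds (Embeds-refine (here refl) E) s)

  Wide : Letter → Set
  Wide (letter a l h) = l < h

  Wide-refine : ∀ {c x y} r → All Wide (map (refine c x y) r) → All Wide r
  Wide-refine []                 _        = []
  Wide-refine {c} {x} {y} (letter a l h ∷ r) (p ∷ ps) =
    ≤-<-trans (raise-≤ (c <ᵇ a) false x (λ ()) ≤-refl) (≤-trans p (lower-≤ (a <ᵇ c) false y (λ ()) ≤-refl)) ∷
    Wide-refine r ps

  ⊨-wide : ∀ {w r} → w ⊨ r → All Wide r
  ⊨-wide done         = []
  ⊨-wide (skip p)     = ⊨-wide p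
  ⊨-wide (take {r = r} p q s) = ≤-<-trans p q ∷ Wide-refine r (⊨-wide s)

  -- Monotonicity carries `l < h` from values back to slots, so the filter by `proper` discards only
  -- suffixes that cannot occur.
  wide-proper : ∀ {γ : ℕ → ℕ} r → Monotone γ → All Wide (map (shift γ) r) → T (proper r)
  wide-proper []                 mono _        = _
  wide-proper (letter a l h ∷ r) mono (p ∷ ps) =
    Equivalence.from T-∧ (<⇒<ᵇ (≰⇒> (<⇒≱ p ∘ mono)) , wide-proper r mono ps)

  module _ {A : Set} {P : Pred A 0ℓ} (p : A → Bool) where

    Any-filter⁻ : ∀ xs → Any P (filterᵇ p xs) → Any P xs
    Any-filter⁻ (x ∷ xs) i with p x
    Any-filter⁻ (x ∷ xs) i         | false = there (Any-filter⁻ xs i)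
    Any-filter⁻ (x ∷ xs) (here i)  | true  = here i
    Any-filter⁻ (x ∷ xs) (there i) | true  = there (Any-filter⁻ xs i)

    Any-filter⁺ : (∀ {x} → P x → T (p x)) → ∀ xs → Any P xs → Any P (filterᵇ p xs)
    Any-filter⁺ imp (x ∷ xs) i with p x in eq
    Any-filter⁺ imp (x ∷ xs) (here i)  | false = ⊥-elim (subst T eq (imp i))
    Any-filter⁺ imp (x ∷ xs) (there i) | false = Any-filter⁺ imp xs i
    Any-filter⁺ imp (x ∷ xs) (here i)  | true  = here i
    Any-filter⁺ imp (x ∷ xs) (there i) | true  = there (Any-filter⁺ imp xs i)

  -- `P r` will say that `r`, for fixed slot sizes, occurs in a fixed word. Validity of the normal
  -- form thus rests on `embeds` alone, whatever order the codes produce.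
  module _ (P : Pred Suffix 0ℓ) (P-proper : ∀ {r} → P r → T (proper r))
           (P-embeds : ∀ k e f → T (embeds [] k e f) → P e → P f) where

    checked⁺ : ∀ r r′ → P r → P (checked r r′)
    checked⁺ r r′ p with embeds [] 0 r r′ in eq | embeds [] 0 r′ r
    ... | false | _     = p
    ... | true  | false = p
    ... | true  | true  = P-embeds 0 r r′ (subst T (sym eq) _) p

    checked⁻ : ∀ r r′ → P (checked r r′) → P r
    checked⁻ r r′ p with embeds [] 0 r r′ | embeds [] 0 r′ r in eq
    ... | false | _     = p
    ... | true  | false = p
    ... | true  | true  = P-embeds 0 r′ r (subst T (sym eq) _) p

    insert⁺ : ∀ x xs → P (proj₂ x) ⊎ Any (P ∘ proj₂) xs → Any (P ∘ proj₂) (insert x xs)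
    insert⁺ x []       (inj₁ p) = here p
    insert⁺ x (y ∷ ys) i with proj₁ x <ᵇ proj₁ y
    insert⁺ x (y ∷ ys) (inj₁ p)         | true  = here p
    insert⁺ x (y ∷ ys) (inj₂ i)         | true  = there i
    insert⁺ x (y ∷ ys) (inj₁ p)         | false = there (insert⁺ x ys (inj₁ p))
    insert⁺ x (y ∷ ys) (inj₂ (here p))  | false = here p
    insert⁺ x (y ∷ ys) (inj₂ (there i)) | false = there (insert⁺ x ys (inj₂ i))

    insert⁻ : ∀ x xs → Any (P ∘ proj₂) (insert x xs) → P (proj₂ x) ⊎ Any (P ∘ proj₂) xs
    insert⁻ x []       (here p) = inj₁ p
    insert⁻ x (y ∷ ys) i with proj₁ x <ᵇ proj₁ y
    insert⁻ x (y ∷ ys) (here p)  | true  = inj₁ p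
    insert⁻ x (y ∷ ys) (there i) | true  = inj₂ i
    insert⁻ x (y ∷ ys) (here p)  | false = inj₂ (here p)
    insert⁻ x (y ∷ ys) (there i) | false with insert⁻ x ys i
    ... | inj₁ p = inj₁ p
    ... | inj₂ j = inj₂ (there j)

    sorted : List Suffix → List Coded
    sorted = foldr (λ r → insert (encode (checked r (standardise r)))) []

    sorted⁺ : ∀ A → Any P A → Any (P ∘ proj₂) (sorted A)
    sorted⁺ (r ∷ A) (here p)  = insert⁺ _ (sorted A) (inj₁ (checked⁺ r (standardise r) p))
    sorted⁺ (r ∷ A) (there i) = insert⁺ _ (sorted A) (inj₂ (sorted⁺ A i))

    sorted⁻ : ∀ A → Any (P ∘ proj₂) (sorted A) → Any P A
    sorted⁻ (r ∷ A) i with insert⁻ _ (sorted A) i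
    ... | inj₁ p = here (checked⁻ r (standardise r) p)
    ... | inj₂ j = there (sorted⁻ A j)

    redundant-sound : ∀ n r acc → T (redundant n r acc) → P r → Any P acc
    redundant-sound n r acc t p = Any.map (λ {f} u → P-embeds _ r f u p) (Anyₚ.any⁻ _ acc t)

    prune⁺ : ∀ acc xs → Any P acc ⊎ Any (P ∘ proj₂) xs → Any P (prune acc xs)
    prune⁺ acc []             (inj₁ i) = Anyₚ.reverse⁺ i
    prune⁺ acc ((_ , r) ∷ xs) i with redundant (length r) r acc in eq
    prune⁺ acc ((_ , r) ∷ xs) (inj₁ i)         | true  = prune⁺ acc xs (inj₁ i)
    prune⁺ acc ((_ , r) ∷ xs) (inj₂ (here p))  | true  =
      prune⁺ acc xs (inj₁ (redundant-sound (length r) r acc (subst T (sym eq) _) p))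
    prune⁺ acc ((_ , r) ∷ xs) (inj₂ (there i)) | true  = prune⁺ acc xs (inj₂ i)
    prune⁺ acc ((_ , r) ∷ xs) (inj₁ i)         | false = prune⁺ (r ∷ acc) xs (inj₁ (there i))
    prune⁺ acc ((_ , r) ∷ xs) (inj₂ (here p))  | false = prune⁺ (r ∷ acc) xs (inj₁ (here p))
    prune⁺ acc ((_ , r) ∷ xs) (inj₂ (there i)) | false = prune⁺ (r ∷ acc) xs (inj₂ i)

    prune⁻ : ∀ acc xs → Any P (prune acc xs) → Any P acc ⊎ Any (P ∘ proj₂) xs
    prune⁻ acc []             i = inj₁ (Anyₚ.reverse⁻ i)
    prune⁻ acc ((_ , r) ∷ xs) i with redundant (length r) r acc
    ... | true  with prune⁻ acc xs i
    ...   | inj₁ j = inj₁ j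
    ...   | inj₂ j = inj₂ (there j)
    prune⁻ acc ((_ , r) ∷ xs) i | false with prune⁻ (r ∷ acc) xs i
    ...   | inj₁ (here p)  = inj₂ (here p)
    ...   | inj₁ (there j) = inj₁ j
    ...   | inj₂ j         = inj₂ (there j)

    normalise⁺ : ∀ A → Any P A → Any P (normalise A)
    normalise⁺ A i = prune⁺ [] _ (inj₂ (sorted⁺ _ (Any-filter⁺ proper P-proper A i)))

    normalise⁻ : ∀ A → Any P (normalise A) → Any P A
    normalise⁻ A i with prune⁻ [] _ i
    ... | inj₂ j = Any-filter⁻ proper A (sorted⁻ _ j)

  -- Dead states

  prefix-<-prefix : ∀ g l h → All (0 <_) g → l < length g → l < h → prefix g l < prefix g h
  prefix-<-prefix (x ∷ g) zero    (suc h) (p ∷ ps) _       _       = <-≤-trans p (m≤m+n x _)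
  prefix-<-prefix (x ∷ g) (suc l) (suc h) (p ∷ ps) (s≤s u) (s≤s v) = +-monoʳ-< x (prefix-<-prefix g l h ps u v)

  prefix-<-sum : ∀ g l → All (0 <_) g → l < length g → prefix g l < sum g
  prefix-<-sum (x ∷ g) zero    (p ∷ ps) _       = <-≤-trans p (m≤m+n x _)
  prefix-<-sum (x ∷ g) (suc l) (p ∷ ps) (s≤s u) = +-monoʳ-< x (prefix-<-sum g l ps u)

  tabulate-⊨ : ∀ {n} (f : Fin n → ℕ) i {a l h} → l ≤ f i → f i < h → tabulate f ⊨ letter a l h ∷ []
  tabulate-⊨ f zero    p q = take p q done
  tabulate-⊨ f (suc i) p q = skip (tabulate-⊨ (f ∘ suc) i p q)

  -- The smallest value of slot `l` is `prefix g l`. It lies below `prefix g h` because the slots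
  -- are nonempty, and like every value it is played somewhere in `π`.
  forced-sound : ∀ s r → T (forced s r) → ∀ g → length g ≡ s → All (0 <_) g →
                 (π : Permutation′ (sum g)) → word π ⊨ map (shift (prefix g)) r
  forced-sound s []                 t g len  pos π = done
  forced-sound s (letter a l h ∷ []) t g refl pos π with ∧⁻ (l <ᵇ h) t
  ... | u , v = tabulate-⊨ _ (π ⟨$⟩ˡ p) (≤-reflexive (sym eq)) (subst (_< prefix g h) (sym eq)
      (prefix-<-prefix g l h pos l<s (<ᵇ⇒< l h u)))
    where
    l<s = <ᵇ⇒< l s v
    p   = fromℕ< (prefix-<-sum g l pos l<s)
    eq : toℕ (π ⟨$⟩ʳ (π ⟨$⟩ˡ p)) ≡ prefix g l
    eq = trans (cong toℕ (inverseʳ π)) (Finₚ.toℕ-fromℕ< _)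

  data Located : List ℕ → ℕ → Set where
    located : ∀ g₁ a b g₂ → Located (g₁ ++ suc (a + b) ∷ g₂) (sum g₁ + a)

  locate : ∀ g j → j < sum g → Located g j
  locate (x ∷ g) j j<x+g with j <? x
  ... | yes j<x = subst (λ y → Located (y ∷ g) j) (m+[n∸m]≡n j<x) (located [] j (x ∸ suc j) g)
  ... | no  j≮x with locate g (j ∸ x) (+-cancelˡ-< x _ _ (subst (_< x + sum g) (sym (m+[n∸m]≡n (≮⇒≥ j≮x))) j<x+g))
  ...   | L = subst (Located (x ∷ g)) (m+[n∸m]≡n (≮⇒≥ j≮x)) (extend L)
    where
    extend : ∀ {g j} → Located g j → Located (x ∷ g) (x + j)
    extend (located g₁ a b g₂) = subst (Located _) (+-assoc x (sum g₁) a) (located (x ∷ g₁) a b g₂)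

  prefix-down-merged : ∀ g₁ a b g₂ k → down (sum g₁ + a) (prefix (g₁ ++ suc (a + b) ∷ g₂) k) ≡
                       prefix (g₁ ++ (a + b) ∷ g₂) k
  prefix-down-merged g₁       a b g₂ zero    = down-zero (sum g₁ + a)
  prefix-down-merged []       a b g₂ (suc k) rewrite +-assoc a b (prefix g₂ k) = down-suc-+ a _
  prefix-down-merged (x ∷ g₁) a b g₂ (suc k) rewrite +-assoc x (sum g₁) a =
    trans (down-+ x (sum g₁ + a) _) (cong (x +_) (prefix-down-merged g₁ a b g₂ k))

  void-++ : ∀ g₁ g₂ → void (length g₁) (g₁ ++ g₂) ≡ g₁ ++ 0 ∷ g₂
  void-++ []       g₂ = refl
  void-++ (x ∷ g₁) g₂ = cong (x ∷_) (void-++ g₁ g₂)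

  -- Forbidding fewer suffixes can only raise the count, so a count of 0 for the relevant suffixes
  -- forces 0 for all of them.
  number-relevant : ∀ s g A n → number (inst g A) n ≤ number (inst g (relevant s A)) n
  number-relevant s g A n = number-mono {inst g (relevant s A)} {inst g A} n λ π →
    Anyₚ.map⁺ ∘ Any-filter⁻ (λ r → (length r ≤ᵇ s) ∧ proper r) A ∘ Anyₚ.map⁻

  sum-middle : ∀ g₁ x g₂ → sum (g₁ ++ suc x ∷ g₂) ≡ suc (sum (g₁ ++ x ∷ g₂))
  sum-middle []       x g₂ = refl
  sum-middle (y ∷ g₁) x g₂ = trans (cong (y +_) (sum-middle g₁ x g₂)) (+-suc y _)

  number-forced : ∀ s A g → T (any (forced s) A) → length g ≡ s → All (0 <_) g → number (inst g A) (sum g) ≡ 0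
  number-forced s A g t len pos = number-zero {inst g A} (sum g) λ π →
    Anyₚ.map⁺ (Any.map (λ {r} u → forced-sound s r u g len pos π) (Anyₚ.any⁻ (forced s) A t))

  -- Induction on the number of slots, then on the number of values. The first value played either
  -- exhausts its slot, which is the case tested by `dead?`, or leaves all slots nonempty with fewer
  -- values.
  dead-sound : ∀ s A → T (dead? s A) → ∀ n g → length g ≡ s → All (0 <_) g → sum g ≡ n → number (inst g A) n ≡ 0
  dead-sound zero    A t n g len pos refl = number-forced 0 A g t len pos
  dead-sound (suc s) A t n g len pos tot with ∨⁻ (any (forced (suc s)) A) t
  dead-sound (suc s) A t n g len pos refl | inj₁ u = number-forced (suc s) A g u len pos
  dead-sound (suc s) A t zero (suc x ∷ g) len (p ∷ pos) () | inj₂ u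
  dead-sound (suc s) A t (suc n) g len pos tot | inj₂ u = trans (number-suc (inst g A) n)
    (∑<-zero (suc n) λ j j<n → each g j len pos tot (locate g j (subst (j <_) (sym tot) j<n)))
    where
    shrink : ∀ g₁ a b g₂ → 0 < a + b → let g = g₁ ++ suc (a + b) ∷ g₂ ; j = sum g₁ + a in
             length g ≡ suc s → All (0 <_) g → sum g ≡ suc n → number (step (down j) j j (inst g A)) n ≡ 0
    shrink g₁ a b g₂ 0<a+b len pos tot = n≤0⇒n≡0 (≤-trans
      -- Every suffix survives as the first entry of `advance`, where the new letter is ignored; the
      -- two parts of the slot are treated as one slot of size `a + b`.
      (number-mono {inst g⁻ A} {step (down j) j j (inst (g₁ ++ suc (a + b) ∷ g₂) A)} n λ π i →
        Anyₚ.concatMap⁺ (advance (down j) j j) (Anyₚ.map⁺ (Any.map (λ {r} p → here (subst (word π ⊨_)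
          (sym (map-shift-∘ (prefix-down-merged g₁ a b g₂) r)) p)) (Anyₚ.map⁻ i))))
      (≤-reflexive (dead-sound (suc s) A t n g⁻
        (trans (Listₚ.length-++-sucʳ g₁ (a + b) g₂) (trans (sym (Listₚ.length-++-sucʳ g₁ (suc (a + b)) g₂)) len))
        (Allₚ.++⁺ (Allₚ.++⁻ˡ g₁ pos) (0<a+b ∷ All.tail (Allₚ.++⁻ʳ g₁ pos)))
        (suc-injective (trans (sym (sum-middle g₁ (a + b) g₂)) tot)))))
      where
      g⁻ = g₁ ++ (a + b) ∷ g₂
      j  = sum g₁ + a

    each : ∀ g j → length g ≡ suc s → All (0 <_) g → sum g ≡ suc n → Located g j →
           number (step (down j) j j (inst g A)) n ≡ 0
    each _ _ len pos tot (located g₁ zero zero g₂) = begin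
      number (step (down j) j j (inst (g₁ ++ 1 ∷ g₂) A)) n
        ≡⟨ cong (λ B → number B n) (step-middle 0 0 g₂ g₁ A) ⟩
      number (inst (g₁ ++ 0 ∷ 0 ∷ g₂) (middle i A)) n
        ≡⟨ cong (λ g → number (inst g (middle i A)) n)
             (sym (trans (cong (void i) (void-++ g₁ g₂)) (void-++ g₁ (0 ∷ g₂)))) ⟩
      number (inst (void i (void i (g₁ ++ g₂))) (middle i A)) n
        ≡⟨ cong (λ B → number B n) (inst-fill i (g₁ ++ g₂) i≤ A) ⟩
      number (inst (g₁ ++ g₂) (fill i A)) n
        ≡⟨ n≤0⇒n≡0 (≤-trans (number-relevant s (g₁ ++ g₂) (fill i A) n) (≤-reflexive
             (dead-sound s (relevant s (fill i A)) dead n (g₁ ++ g₂) len′ pos′ tot′))) ⟩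
      0 ∎
      where
      i = length g₁
      j = sum g₁ + 0
      len′ : length (g₁ ++ g₂) ≡ s
      len′ = suc-injective (trans (sym (Listₚ.length-++-sucʳ g₁ 1 g₂)) len)
      i≤ : i ≤ length (g₁ ++ g₂)
      i≤ = Listₚ.length-++-≤ˡ g₁
      pos′ : All (0 <_) (g₁ ++ g₂)
      pos′ = Allₚ.++⁺ (Allₚ.++⁻ˡ g₁ pos) (All.tail (Allₚ.++⁻ʳ g₁ pos))
      tot′ : sum (g₁ ++ g₂) ≡ n
      tot′ = suc-injective (trans (cong suc (trans (sum-++ g₁ g₂) (sym (sum-++ g₁ (0 ∷ g₂)))))
               (trans (sym (sum-middle g₁ 0 g₂)) tot))
      dead : T (dead? s (relevant s (fill i A)))
      dead = All.lookup (Allₚ.all⁺ _ (applyUpTo id (suc s)) u) (Anyₚ.applyUpTo⁺ id refl (s≤s (subst (i ≤_) len′ i≤)))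
    each _ _ len pos tot (located g₁ (suc a) b g₂) = shrink g₁ (suc a) b g₂ z<s len pos tot
    each _ _ len pos tot (located g₁ zero (suc b) g₂) = shrink g₁ zero (suc b) g₂ z<s len pos tot

  completions-hopeless : ∀ n → completions hopeless n ≡ 0
  completions-hopeless zero    = refl
  completions-hopeless (suc n) = refl

  completions-outcome : ∀ q n → completions (outcome q) n ≡ completions q n
  completions-outcome (s , A) n with dead? s (relevant s A) in eq
  ... | true  = trans (completions-hopeless n) (sym (trans (∑ᶜ-cong s n {k = λ _ → 0} λ g len pos tot → n≤0⇒n≡0
          (≤-trans (number-relevant s g A n) (≤-reflexive
            (dead-sound s (relevant s A) (subst T (sym eq) _) n g len pos tot)))) (∑ᶜ-zero s n)))
  ... | false = ∑ᶜ-cong s n λ g _ _ _ → number-cong {inst g (normalise A)} {inst g A} n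
          (λ π → Anyₚ.map⁺ ∘ normalise⁻ (P g π) (P-proper g π) (P-embeds g π) A ∘ Anyₚ.map⁻)
          (λ π → Anyₚ.map⁺ ∘ normalise⁺ (P g π) (P-proper g π) (P-embeds g π) A ∘ Anyₚ.map⁻)
    where
    P : List ℕ → Permutation′ n → Pred Suffix 0ℓ
    P g π r = word π ⊨ map (shift (prefix g)) r
    P-proper : ∀ g π {r} → P g π r → T (proper r)
    P-proper g π {r} = wide-proper r (prefix-mono g) ∘ ⊨-wide
    P-embeds : ∀ g π k e f → T (embeds [] k e f) → P g π e → P g π f
    P-embeds g π k e f t = ⊨-embeds (Embeds-shift (prefix-mono g) (embeds-sound [] k e f t))

  -- Transfer matrices

  open import Data.Integer using (+_; -_)

  Vector = List ℤ

  at : Vector → ℕ → ℤ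
  at []      _       = 0ℤ
  at (x ∷ _) zero    = x
  at (_ ∷ v) (suc k) = at v k

  total : List ℤ → ℤ
  total = foldr ℤ._+_ 0ℤ

  infixl 6 _⊞_
  _⊞_ : Vector → Vector → Vector
  []      ⊞ v       = v
  (x ∷ u) ⊞ []      = x ∷ u
  (x ∷ u) ⊞ (y ∷ v) = x ℤ.+ y ∷ u ⊞ v

  scale : ℤ → Vector → Vector
  scale c = map (c ℤ.*_)

  at-⊞ : ∀ u v k → at (u ⊞ v) k ≡ at u k ℤ.+ at v k
  at-⊞ []      v       k       = sym (ℤₚ.+-identityˡ _)
  at-⊞ (x ∷ u) []      k       = sym (ℤₚ.+-identityʳ _)
  at-⊞ (x ∷ u) (y ∷ v) zero    = refl
  at-⊞ (x ∷ u) (y ∷ v) (suc k) = at-⊞ u v k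

  at-scale : ∀ c v k → at (scale c v) k ≡ c ℤ.* at v k
  at-scale c []      k       = sym (ℤₚ.*-zeroʳ c)
  at-scale c (x ∷ v) zero    = refl
  at-scale c (x ∷ v) (suc k) = at-scale c v k

  -- The transfer matrix, given by its rows.
  apply : List Node → Vector → Vector
  apply M v = map (λ x → total (map (at v) (Node.targets x))) M

  iter : List Node → ℕ → Vector → Vector
  iter M zero    v = v
  iter M (suc n) v = iter M n (apply M v)

  poly : List Node → List ℤ → Vector → Vector
  poly M []      v = []
  poly M (c ∷ p) v = scale c v ⊞ poly M p (apply M v)

  reads : List Node → ℕ → Vector → List ℤ
  reads M zero    v = []
  reads M (suc n) v = at v 1 ∷ reads M n (apply M v)

  -- Σ cᵢ f (n + i), a recurrence operator; poly is its analogue for the powers of the transfer matrix.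
  infix 8 _⟨_⟩
  _⟨_⟩ : List ℤ → (ℕ → ℤ) → ℕ → ℤ
  ([] ⟨ f ⟩)    n = 0ℤ
  ((c ∷ p) ⟨ f ⟩) n = c ℤ.* f n ℤ.+ (p ⟨ f ⟩) (suc n)

  targetsAt : List Node → ℕ → List ℕ
  targetsAt []      _       = []
  targetsAt (x ∷ _) zero    = Node.targets x
  targetsAt (_ ∷ M) (suc k) = targetsAt M k

  total-linear : ∀ c (f g : ℕ → ℤ) ks → total (map (λ k → c ℤ.* f k ℤ.+ g k) ks) ≡
                 c ℤ.* total (map f ks) ℤ.+ total (map g ks)
  total-linear c f g []       = lemma c
    where
    lemma : ∀ c → 0ℤ ≡ c ℤ.* 0ℤ ℤ.+ 0ℤ
    lemma = solve-∀
  total-linear c f g (k ∷ ks) = trans (cong (λ z → c ℤ.* f k ℤ.+ g k ℤ.+ z) (total-linear c f g ks)) (lemma c _ _ _ _)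
    where
    lemma : ∀ c x y u v → c ℤ.* x ℤ.+ y ℤ.+ (c ℤ.* u ℤ.+ v) ≡ c ℤ.* (x ℤ.+ u) ℤ.+ (y ℤ.+ v)
    lemma = solve-∀

  total-zero : ∀ {f : ℕ → ℤ} → (∀ k → f k ≡ 0ℤ) → ∀ ks → total (map f ks) ≡ 0ℤ
  total-zero eq []       = refl
  total-zero eq (k ∷ ks) = trans (cong₂ ℤ._+_ (eq k) (total-zero eq ks)) refl

  module _ (M : List Node) where

    Recursive : (ℕ → ℕ → ℤ) → Set
    Recursive f = ∀ k n → f k (suc n) ≡ total (map (λ j → f j n) (targetsAt M k))

    -- The transfer matrix acts on states and the recurrence operator on lengths, so the two
    -- commute.
    Recursive-⟨⟩ : ∀ p {f} → Recursive f → Recursive λ k → p ⟨ f k ⟩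
    Recursive-⟨⟩ []      rec k n = sym (total-zero (λ _ → refl) (targetsAt M k))
    Recursive-⟨⟩ (c ∷ p) {f} rec k n = trans
      (cong₂ (λ x y → c ℤ.* x ℤ.+ y) (rec k n) (Recursive-⟨⟩ p rec k (suc n)))
      (sym (total-linear c (λ j → f j n) (λ j → (p ⟨ f j ⟩) (suc n)) (targetsAt M k)))

    Recursive-zero : ∀ {f} → Recursive f → ∀ n₀ → (∀ k → f k n₀ ≡ 0ℤ) → ∀ n k → f k (n₀ + n) ≡ 0ℤ
    Recursive-zero {f} rec n₀ eq zero    k = trans (cong (f k) (+-identityʳ n₀)) (eq k)
    Recursive-zero {f} rec n₀ eq (suc n) k = trans (cong (f k) (+-suc n₀ n))
      (trans (rec k (n₀ + n)) (total-zero (Recursive-zero rec n₀ eq n) (targetsAt M k)))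

    at-apply : ∀ v k → at (apply M v) k ≡ total (map (at v) (targetsAt M k))
    at-apply v = go M
      where
      go : ∀ M k → at (apply M v) k ≡ total (map (at v) (targetsAt M k))
      go []      k       = refl
      go (x ∷ M) zero    = refl
      go (x ∷ M) (suc k) = go M k

    Represents : (ℕ → ℕ → ℤ) → ℕ → Vector → Set
    Represents f n v = ∀ k → at v k ≡ f k n

    module _ {f : ℕ → ℕ → ℤ} (rec : Recursive f) where

      apply-represents : ∀ {n} v → Represents f n v → Represents f (suc n) (apply M v)
      apply-represents {n} v rep k = trans (at-apply v k)
        (trans (cong total (Listₚ.map-cong rep (targetsAt M k))) (sym (rec k n)))

      iter-represents : ∀ m {n} v → Represents f n v → Represents f (m + n) (iter M m v)
      iter-represents zero    v rep = rep
      iter-represents (suc m) {n} v rep k =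
        trans (iter-represents m (apply M v) (apply-represents v rep) k) (cong (f k) (+-suc m n))

      poly-represents : ∀ p {n} v → Represents f n v → Represents (λ k → p ⟨ f k ⟩) n (poly M p v)
      poly-represents []      v rep k = refl
      poly-represents (c ∷ p) {n} v rep k = trans (at-⊞ (scale c v) _ k) (cong₂ ℤ._+_
        (trans (at-scale c v k) (cong (c ℤ.*_) (rep k))) (poly-represents p (apply M v) (apply-represents v rep) k))

      reads-represents : ∀ m {n} v → Represents f n v → reads M m v ≡ map (f 1) (applyUpTo (_+ n) m)
      reads-represents zero    v rep = refl
      reads-represents (suc m) {n} v rep = cong₂ _∷_ (rep 1)
        (trans (reads-represents m (apply M v) (apply-represents v rep))
          (cong (map (f 1)) (applyUpTo-cong m λ i → +-suc i n)))
        where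
        applyUpTo-cong : ∀ {g h : ℕ → ℕ} m → (∀ i → g i ≡ h i) → applyUpTo g m ≡ applyUpTo h m
        applyUpTo-cong zero    eq = refl
        applyUpTo-cong (suc m) eq = cong₂ _∷_ (eq 0) (applyUpTo-cong m (eq ∘ suc))

  monic-leading : ∀ cs d n → (∀ i → i < length cs → d (n + i) ≡ 0ℤ) → ((cs ++ 1ℤ ∷ []) ⟨ d ⟩) n ≡ d (n + length cs)
  monic-leading []       d n eq = trans (lemma (d n)) (cong d (sym (+-identityʳ n)))
    where
    lemma : ∀ x → 1ℤ ℤ.* x ℤ.+ 0ℤ ≡ x
    lemma = solve-∀
  monic-leading (c ∷ cs) d n eq = trans
    (cong₂ (λ x y → c ℤ.* x ℤ.+ y) (trans (cong d (sym (+-identityʳ n))) (eq 0 z<s))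
      (monic-leading cs d (suc n) λ i i< → trans (cong d (sym (+-suc n i))) (eq (suc i) (s<s i<))))
    (trans (lemma c (d (suc n + length cs))) (cong d (sym (+-suc n (length cs)))))
    where
    lemma : ∀ c x → c ℤ.* 0ℤ ℤ.+ x ≡ x
    lemma = solve-∀

  monic-vanishes : ∀ cs d n₀ → (∀ n → ((cs ++ 1ℤ ∷ []) ⟨ d ⟩) (n₀ + n) ≡ 0ℤ) →
                   (∀ i → i < length cs → d (n₀ + i) ≡ 0ℤ) → ∀ n → d (n₀ + n) ≡ 0ℤ
  monic-vanishes cs d n₀ rec start n = trans (cong d (sym (+-identityʳ (n₀ + n)))) (window n 0 z≤n)
    where
    extend : ∀ n → (∀ i → i < length cs → d (n₀ + n + i) ≡ 0ℤ) → ∀ i → i ≤ length cs → d (n₀ + n + i) ≡ 0ℤ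
    extend n eq i i≤ with m≤n⇒m<n∨m≡n i≤
    ... | inj₁ i<  = eq i i<
    ... | inj₂ refl = trans (sym (monic-leading cs d (n₀ + n) eq)) (rec n)

    -- The window includes `i = length cs`, one more zero than the order of the recurrence, so the
    -- window shifted by one starts with enough known zeros.
    window : ∀ n i → i ≤ length cs → d (n₀ + n + i) ≡ 0ℤ
    window zero    = extend 0 λ i i< → trans (cong (λ m → d (m + i)) (+-identityʳ n₀)) (start i i<)
    window (suc n) = extend (suc n) λ i i< → trans
      (cong d (trans (cong (_+ i) (+-suc n₀ n)) (sym (+-suc (n₀ + n) i)))) (window n (suc i) i<)

  -- For length 0 no slot can be nonempty, and the empty word contains only the empty suffix.
  initially : State → ℤ
  initially (zero  , A) = if any null A then 0ℤ else 1ℤ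
  initially (suc _ , _) = 0ℤ

  zeros? : List ℤ → Bool
  zeros? = all λ x → ⌊ x ℤₚ.≟ 0ℤ ⌋

  -- Let w = p(A) Aⁿ⁰ v₀ for the transfer matrix A.  That the recurrence p holds from n₀ on means that the entry
  -- of all Aⁿ w at the initial state is 0.  If c is monic of degree r and c(A) w = 0, it suffices to see
  -- this for n < r.  The list cs holds the coefficients of c below the leading one.
  module _ (p cs vs : List ℤ) (n₀ : ℕ) (q : State) where

    residual? : List Node → Vector → Bool
    residual? M w = zeros? (reads M (length cs) w) ∧ zeros? (poly M (cs ++ 1ℤ ∷ []) w)

    vector? : List Node → Vector → Bool
    -- Three applications of the matrix, as the listed values start at length 3.
    vector? M v = ⌊ Listₚ.≡-dec ℤₚ._≟_ (reads M (length vs) (iter M 3 v)) vs ⌋ ∧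
      residual? M (poly M p (iter M n₀ v))

    valid? : List Node → Bool
    valid? M = closed M ∧ ⌊ stateAt M 1 ≟ˢ q ⌋ ∧ vector? M (map (initially ∘ Node.state) M)

  completions-initially : ∀ q → + completions q 0 ≡ initially q
  completions-initially (suc s , A) = refl
  completions-initially (zero  , A) = go A
    where
    go : ∀ A → + completions (0 , A) 0 ≡ initially (0 , A)
    go []             = refl
    go ([] ∷ A)       = refl
    go ((letter a l h ∷ r) ∷ A) = trans (cong +_ (number-cong {inst [] ((letter a l h ∷ r) ∷ A)} {inst [] A} 0
       (λ { π (there i) → i }) (λ π i → there i))) (go A)

  does⇒ : ∀ {A : Set} (a? : Dec A) → T (does a?) → A
  does⇒ (yes a) _ = a

  Closed : List Node → List Node → Set
  Closed M = All λ x → T (matches M (Node.successors x) (Node.targets x))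

  module _ (M : List Node) (M-closed : Closed M M) where

    value : ℕ → ℕ → ℤ
    value k n = + completions (stateAt M k) n

    matches-sum : ∀ n qs ks → T (matches M qs ks) →
                  + sum (map (λ q → completions q n) qs) ≡ total (map (λ k → value k n) ks)
    matches-sum n []       []       t = refl
    matches-sum n (q ∷ qs) (k ∷ ks) t with ∧⁻ (does (q ≟ˢ stateAt M k)) t
    ... | t₁ , t₂ = cong₂ (λ x y → + completions x n ℤ.+ y) (does⇒ (q ≟ˢ stateAt M k) t₁)
      (matches-sum n qs ks t₂)

    value-recursive : Recursive M value
    value-recursive k n = go M M-closed k
      where
      go : ∀ xs → Closed M xs → ∀ k →
           + completions (stateAt xs k) (suc n) ≡ total (map (λ j → value j n) (targetsAt xs k))
      go []       _        k       = cong +_ (completions-hopeless (suc n))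
      go (x ∷ xs) (p ∷ ps) (suc k) = go xs ps k
      go (node q qs ks refl ∷ xs) (p ∷ ps) zero = trans (cong +_ (trans (completions-suc q n)
        (cong sum (trans (sym (Listₚ.map-cong (λ q → completions-outcome q n) (moves q))) (Listₚ.map-∘ (moves q))))))
        (matches-sum n qs ks p)

    value-initially : Represents M value 0 (map (initially ∘ Node.state) M)
    value-initially = go M
      where
      go : ∀ xs k → at (map (initially ∘ Node.state) xs) k ≡ + completions (stateAt xs k) 0
      go []       k       = refl
      go (x ∷ xs) zero    = sym (completions-initially (Node.state x))
      go (x ∷ xs) (suc k) = go xs k

  zeros-at : ∀ v → T (zeros? v) → ∀ k → at v k ≡ 0ℤ
  zeros-at []      t k       = refl
  zeros-at (x ∷ v) t k with ∧⁻ ⌊ x ℤₚ.≟ 0ℤ ⌋ t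
  zeros-at (x ∷ v) t zero    | t₁ , t₂ = toWitness t₁
  zeros-at (x ∷ v) t (suc k) | t₁ , t₂ = zeros-at v t₂ k

  reads-at : ∀ (f : ℕ → ℤ) n m → T (zeros? (map f (applyUpTo (_+ n) m))) → ∀ i → i < m → f (n + i) ≡ 0ℤ
  reads-at f n m t i i<m = trans (cong f (+-comm n i)) (All.lookup {P = λ k → f k ≡ 0ℤ}
    (All.map (λ u → toWitness u) (Allₚ.map⁻ (Allₚ.all⁺ _ (map f (applyUpTo (_+ n) m)) t)))
    (∈-applyUpTo⁺ (_+ n) i<m))

  valid-sound : ∀ p cs vs n₀ q M → T (valid? p cs vs n₀ q M) → let f = λ n → + completions q n in
                (map f (applyUpTo (_+ 3) (length vs)) ≡ vs) × (∀ n → (p ⟨ f ⟩) (n₀ + n) ≡ 0ℤ)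
  valid-sound p cs vs n₀ q M t with ∧⁻ (closed M) t
  ... | t₁ , t′ with ∧⁻ ⌊ stateAt M 1 ≟ˢ q ⌋ t′
  ... | t₂ , t″ with toWitness {a? = stateAt M 1 ≟ˢ q} t₂
  ... | refl with ∧⁻ ⌊ Listₚ.≡-dec ℤₚ._≟_ (reads M (length vs) (iter M 3 v₀)) vs ⌋ t″
    where v₀ = map (initially ∘ Node.state) M
  ... | t₃ , t‴ with ∧⁻ (zeros? (reads M (length cs) (poly M p (iter M n₀ (map (initially ∘ Node.state) M))))) t‴
  ... | t₄ , t₅ =
      trans (sym (reads-represents M rec (length vs) (iter M 3 v₀) (iter-represents M rec 3 v₀ rep))) (toWitness t₃) ,
      monic-vanishes cs (p ⟨ value M cl 1 ⟩) n₀
        -- All entries of c(A) w are 0 and remain so under further applications of A; only the entry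
        -- 1 of the initial state is used.
        (λ n → Recursive-zero M (Recursive-⟨⟩ M (cs ++ 1ℤ ∷ []) rec′) n₀
          (λ k → trans (sym (poly-represents M rec′ (cs ++ 1ℤ ∷ []) w rep′ k))
            (zeros-at (poly M (cs ++ 1ℤ ∷ []) w) t₅ k)) n 1)
        (reads-at (p ⟨ value M cl 1 ⟩) n₀ (length cs)
          (subst (T ∘ zeros?) (reads-represents M rec′ (length cs) w rep′) t₄))
    where
    v₀ = map (initially ∘ Node.state) M
    w  = poly M p (iter M n₀ v₀)
    cl = Allₚ.all⁺ _ M t₁
    rec = value-recursive M cl
    rec′ = Recursive-⟨⟩ M p rec
    rep = value-initially M cl
    rep′ = poly-represents M rec p (iter M n₀ v₀)
      (subst (λ n → Represents M (value M cl) n (iter M n₀ v₀)) (+-identityʳ n₀) (iter-represents M rec n₀ v₀ rep))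

  -- Occurrences in permutations

  Compatible : ℕ → ℕ → Letter → ℕ → Set
  Compatible a x (letter b _ _) y = (a < b → x < y) × (b < a → y < x)

  Fits : Suffix → List ℕ → Set
  Fits []                 []      = ⊤
  Fits (letter a l h ∷ r) (x ∷ u) = (l ≤ x × x < h) × Pointwise (Compatible a x) r u × Fits r u
  Fits _                  _       = ⊥

  refine-compatible⁻ : ∀ {a x b y c d} r u → Pointwise (Compatible b y) (map (refine a c d) r) u →
                       Pointwise (Compatible b y) r u
  refine-compatible⁻ []               []      []       = []
  refine-compatible⁻ (letter _ _ _ ∷ r) (y ∷ u) (p ∷ ps) = p ∷ refine-compatible⁻ {x = y} r u ps

  refine-compatible⁺ : ∀ {a b y c d} r u → Pointwise (Compatible b y) r u →
                       Pointwise (Compatible b y) (map (refine a c d) r) u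
  refine-compatible⁺ []               []      []       = []
  refine-compatible⁺ (letter _ _ _ ∷ r) (y ∷ u) (p ∷ ps) = p ∷ refine-compatible⁺ r u ps

  raise⁻ : ∀ l x y b → (if b then l ⊔ suc x else l) ≤ y → l ≤ y × (T b → x < y)
  raise⁻ l x y true  p = m⊔n≤o⇒m≤o l (suc x) p , λ _ → m⊔n≤o⇒n≤o l (suc x) p
  raise⁻ l x y false p = p , λ ()

  raise⁺ : ∀ l x y b → l ≤ y → (T b → x < y) → (if b then l ⊔ suc x else l) ≤ y
  raise⁺ l x y true  p q = ⊔-lub p (q _)
  raise⁺ l x y false p q = p

  lower⁻ : ∀ h x y b → y < (if b then h ⊓ x else h) → y < h × (T b → y < x)
  lower⁻ h x y true  p = ≤-trans p (m⊓n≤m h x) , λ _ → ≤-trans p (m⊓n≤n h x)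
  lower⁻ h x y false p = p , λ ()

  lower⁺ : ∀ h x y b → y < h → (T b → y < x) → y < (if b then h ⊓ x else h)
  lower⁺ h x y true  p q = ⊓-glb p (q _)
  lower⁺ h x y false p q = p

  Fits-refine⁻ : ∀ a x r u → Fits (map (refine a (suc x) x) r) u → Pointwise (Compatible a x) r u × Fits r u
  Fits-refine⁻ a x []                 []      _ = [] , _
  Fits-refine⁻ a x (letter b l h ∷ r) (y ∷ u) ((p , q) , c , f)
    with raise⁻ l x y (a <ᵇ b) p | lower⁻ h x y (b <ᵇ a) q | Fits-refine⁻ a x r u f
  ... | p₁ , p₂ | q₁ , q₂ | cs , f′ =
    ((p₂ ∘ <⇒<ᵇ , q₂ ∘ <⇒<ᵇ) ∷ cs) , (p₁ , q₁) , refine-compatible⁻ {x = y} r u c , f′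

  Fits-refine⁺ : ∀ a x r u → Pointwise (Compatible a x) r u → Fits r u → Fits (map (refine a (suc x) x) r) u
  Fits-refine⁺ a x []                 []      _ _ = _
  Fits-refine⁺ a x (letter b l h ∷ r) (y ∷ u) ((p₂ , q₂) ∷ cs) ((p₁ , q₁) , c , f) =
    (raise⁺ l x y (a <ᵇ b) p₁ (p₂ ∘ <ᵇ⇒< a b) , lower⁺ h x y (b <ᵇ a) q₁ (q₂ ∘ <ᵇ⇒< b a)) ,
    refine-compatible⁺ r u c , Fits-refine⁺ a x r u cs f

  ⊨⇒Fits : ∀ {w r} → w ⊨ r → ∃ λ u → u ⊆ w × Fits r u
  ⊨⇒Fits {w} done     = [] , minimum w , _
  ⊨⇒Fits (skip {x} p) with ⊨⇒Fits p
  ... | u , sub , fits = u , x ∷ʳ sub , fits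
  ⊨⇒Fits (take {x} {a = a} {r = r} p q s) with ⊨⇒Fits s
  ... | u , sub , fits with Fits-refine⁻ a x r u fits
  ... | c , f = x ∷ u , refl ∷ sub , (p , q) , c , f

  Fits⇒⊨ : ∀ {w u} r → u ⊆ w → Fits r u → w ⊨ r
  Fits⇒⊨ []                 []         _ = done
  Fits⇒⊨ []                 (y ∷ʳ sub) f = done
  Fits⇒⊨ (letter _ _ _ ∷ _) []         ()
  Fits⇒⊨ r@(_ ∷ _)          (y ∷ʳ sub) f = skip (Fits⇒⊨ r sub f)
  Fits⇒⊨ (letter a l h ∷ r) (_∷_ {x} {u} refl sub) ((p , q) , c , f) =
    take p q (Fits⇒⊨ _ sub (Fits-refine⁺ a x r u c f))

  whole : ℕ → Pattern → Suffix
  whole n = map λ a → letter a 0 n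

  Increasing : ∀ {k n} → (Fin k → Fin n) → Set
  Increasing ι = ∀ i j → i Fin.< j → ι i Fin.< ι j

  predecessors : ∀ {k n} (ι : Fin k → Fin (suc n)) → (∀ i → zero ≢ ι i) → Increasing ι →
                 ∃ λ (ι′ : Fin k → Fin n) → Increasing ι′ × (∀ i → suc (ι′ i) ≡ ι i)
  predecessors ι nz inc = (λ i → punchOut (nz i)) ,
    (λ i j i<j → s<s⁻¹ (subst₂ Fin._<_ (sym (eq i)) (sym (eq j)) (inc i j i<j))) , eq
    where
    eq : ∀ i → suc (punchOut (nz i)) ≡ ι i
    eq i = Finₚ.punchIn-punchOut (nz i)

  tabulate-⊆ : ∀ {k n} (f : Fin n → ℕ) (ι : Fin k → Fin n) → Increasing ι → tabulate (f ∘ ι) ⊆ tabulate f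
  tabulate-⊆ {zero}          f ι inc = minimum _
  tabulate-⊆ {suc k} {zero}  f ι inc with () ← ι zero
  tabulate-⊆ {suc k} {suc n} f ι inc with ι zero in eq
  ... | zero with predecessors (ι ∘ suc)
                    (λ i z → <-irrefl (cong toℕ (trans eq z)) (inc zero (suc i) z<s))
                    (λ i j i<j → inc (suc i) (suc j) (s<s i<j))
  ...   | ι′ , inc′ , eq′ = refl ∷
    subst (_⊆ tabulate (f ∘ suc)) (Listₚ.tabulate-cong (cong f ∘ eq′)) (tabulate-⊆ (f ∘ suc) ι′ inc′)
  tabulate-⊆ {suc k} {suc n} f ι inc | suc x with predecessors ι nonzero inc
    where
    nonzero : ∀ i → zero ≢ ι i
    nonzero zero    z with () ← trans z eq
    nonzero (suc i) z = n≮0 (subst (λ y → ι zero Fin.< y) (sym z) (inc zero (suc i) z<s))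
  ... | ι′ , inc′ , eq′ = f zero ∷ʳ subst (_⊆ tabulate (f ∘ suc))
    (trans (Listₚ.tabulate-cong (cong f ∘ eq′)) (cong (λ y → f y ∷ tabulate (f ∘ ι ∘ suc)) eq))
    (tabulate-⊆ (f ∘ suc) ι′ inc′)

  ⊆-tabulate : ∀ {n N} (f : Fin n → ℕ) p {u} → u ⊆ tabulate f → Fits (whole N p) u →
               ∃ λ (ι : Fin (length p) → Fin n) → Increasing ι × u ≡ tabulate (f ∘ ι)
  ⊆-tabulate {zero}  f []      []         _ = (λ ()) , (λ ()) , refl
  ⊆-tabulate {suc n} f p       (_ ∷ʳ sub) fits with ⊆-tabulate (f ∘ suc) p sub fits
  ... | ι , inc , eq = suc ∘ ι , (λ i j i<j → s<s (inc i j i<j)) , eq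
  ⊆-tabulate {suc n} f (a ∷ p) (refl ∷ sub) (_ , _ , fits) with ⊆-tabulate (f ∘ suc) p sub fits
  ... | ι , inc , eq = ι′ , inc′ , cong (f zero ∷_) eq
    where
    ι′ : Fin (suc (length p)) → Fin (suc n)
    ι′ zero    = zero
    ι′ (suc i) = suc (ι i)
    inc′ : Increasing ι′
    inc′ zero    (suc j) _         = z<s
    inc′ (suc i) (suc j) (s<s i<j) = s<s (inc i j i<j)

  compatible-lookup : ∀ {a x N} p (g : Fin (length p) → ℕ) → Pointwise (Compatible a x) (whole N p) (tabulate g) →
                      ∀ j → (a < lookup p j → x < g j) × (lookup p j < a → g j < x)
  compatible-lookup (b ∷ p) g (c ∷ cs) zero    = c
  compatible-lookup (b ∷ p) g (c ∷ cs) (suc j) = compatible-lookup p (g ∘ suc) cs j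

  compatible-tabulate : ∀ {a x N} p (g : Fin (length p) → ℕ) →
    (∀ j → (a < lookup p j → x < g j) × (lookup p j < a → g j < x)) →
    Pointwise (Compatible a x) (whole N p) (tabulate g)
  compatible-tabulate []      g c = []
  compatible-tabulate (b ∷ p) g c = c zero ∷ compatible-tabulate p (g ∘ suc) (c ∘ suc)

  Fits-lookup : ∀ {N} p (g : Fin (length p) → ℕ) → Fits (whole N p) (tabulate g) →
                ∀ i j → lookup p i < lookup p j → g i < g j
  Fits-lookup (a ∷ p) g (_ , c , f) zero    zero    a<a = ⊥-elim (<-irrefl refl a<a)
  Fits-lookup (a ∷ p) g (_ , c , f) zero    (suc j)     = proj₁ (compatible-lookup p (g ∘ suc) c j)
  Fits-lookup (a ∷ p) g (_ , c , f) (suc i) zero        = proj₂ (compatible-lookup p (g ∘ suc) c i)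
  Fits-lookup (a ∷ p) g (_ , c , f) (suc i) (suc j)     = Fits-lookup p (g ∘ suc) f i j

  Fits-tabulate : ∀ {N} p (g : Fin (length p) → ℕ) → (∀ i → g i < N) → (∀ i j → lookup p i < lookup p j → g i < g j) →
                  Fits (whole N p) (tabulate g)
  Fits-tabulate []      g bound ord = _
  Fits-tabulate (a ∷ p) g bound ord = (z≤n , bound zero) ,
    compatible-tabulate p (g ∘ suc) (λ j → ord zero (suc j) , ord (suc j) zero) ,
    Fits-tabulate p (g ∘ suc) (bound ∘ suc) (λ i j → ord (suc i) (suc j))

  -- The comparisons go in one direction, so equal letters leave the order of their images open.
  -- This is what a merged pattern needs; for distinct letters `Contains` is recovered by
  -- trichotomy.
  Embedded : ∀ {k n} → (Fin k → ℕ) → Permutation′ n → Set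
  Embedded {k} {n} x π = ∃ λ (ι : Fin k → Fin n) → Increasing ι × (∀ i j → x i < x j → π ⟨$⟩ʳ ι i Fin.< π ⟨$⟩ʳ ι j)

  ⊨⇒Embedded : ∀ {n} (π : Permutation′ n) p → word π ⊨ whole n p → Embedded (lookup p) π
  ⊨⇒Embedded π p s with ⊨⇒Fits s
  ... | u , sub , fits with ⊆-tabulate (toℕ ∘ (π ⟨$⟩ʳ_)) p sub fits
  ... | ι , inc , refl = ι , inc , Fits-lookup p _ fits

  Embedded⇒⊨ : ∀ {n} (π : Permutation′ n) p → Embedded (lookup p) π → word π ⊨ whole n p
  Embedded⇒⊨ π p (ι , inc , ord) =
    Fits⇒⊨ (whole _ p) (tabulate-⊆ _ ι inc) (Fits-tabulate p _ (λ i → Finₚ.toℕ<n _) ord)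

  Contains⇒Embedded : ∀ {n} (π : Permutation′ n) p → Contains p π → Embedded (lookup p) π
  Contains⇒Embedded π p (ι , occ) =
    Vec.lookup ι , (λ i j → proj₁ (occ i j)) , (λ i j → Equivalence.to (proj₂ (occ i j)))

  Distinct : Pattern → Set
  Distinct p = ∀ i j → lookup p i ≡ lookup p j → i ≡ j

  distinct? : ∀ p → Dec (Distinct p)
  distinct? p = Finₚ.all? λ i → Finₚ.all? λ j → (lookup p i ≟ lookup p j) →-dec (i Finₚ.≟ j)

  Embedded⇒Contains : ∀ {n} (π : Permutation′ n) p → Distinct p → Embedded (lookup p) π → Contains p π
  Embedded⇒Contains {n} π p dist (ι , inc , ord) = Vec.tabulate ι , occ
    where
    occ : IsOccurrence p π (Vec.tabulate ι)
    occ i j rewrite Vecₚ.lookup∘tabulate ι i | Vecₚ.lookup∘tabulate ι j = inc i j , mk⇔ (ord i j) from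
      where
      from : π ⟨$⟩ʳ ι i Fin.< π ⟨$⟩ʳ ι j → lookup p i < lookup p j
      from lt with <-cmp (lookup p i) (lookup p j)
      ... | tri< p<q _ _ = p<q
      ... | tri> _ _ q<p = ⊥-elim (<-asym lt (ord j i q<p))
      ... | tri≈ _ p≡q _ with refl ← dist i j p≡q = ⊥-elim (<-irrefl refl lt)

  -- Merging pairs of patterns

  -- The pattern z leaves the order of its letters at the positions s and t open; x and y complete it in the
  -- two possible ways.
  Merges : ∀ {k} → Fin k → Fin k → (z x y : Fin k → ℕ) → Set
  Merges s t z x y = (s Fin.< t) × ∀ i j →
    (z i < z j → x i < x j × y i < y j) ×
    (x i < x j → z i < z j ⊎ (i ≡ s × j ≡ t)) ×
    (y i < y j → z i < z j ⊎ (i ≡ t × j ≡ s))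

  merges? : ∀ {k} s t (z x y : Fin k → ℕ) → Dec (Merges s t z x y)
  merges? s t z x y = (s Finₚ.<? t) ×-dec Finₚ.all? λ i → Finₚ.all? λ j →
    ((z i <? z j) →-dec ((x i <? x j) ×-dec (y i <? y j))) ×-dec
    ((x i <? x j) →-dec ((z i <? z j) ⊎-dec ((i Finₚ.≟ s) ×-dec (j Finₚ.≟ t)))) ×-dec
    ((y i <? y j) →-dec ((z i <? z j) ⊎-dec ((i Finₚ.≟ t) ×-dec (j Finₚ.≟ s))))

  module _ {k} {s t : Fin k} {z x y : Fin k → ℕ} (mg : Merges s t z x y) {n} (π : Permutation′ n) where

    merge-split : Embedded z π → Embedded x π ⊎ Embedded y π
    merge-split (ι , inc , ord) with Finₚ.<-cmp (π ⟨$⟩ʳ ι s) (π ⟨$⟩ʳ ι t)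
    ... | tri< lt _ _ = inj₁ (ι , inc , λ i j xi<xj →
            [ ord i j , (λ { (refl , refl) → lt }) ] (proj₁ (proj₂ (proj₂ mg i j)) xi<xj))
    ... | tri> _ _ gt = inj₂ (ι , inc , λ i j yi<yj →
            [ ord i j , (λ { (refl , refl) → gt }) ] (proj₂ (proj₂ (proj₂ mg i j)) yi<yj))
    ... | tri≈ _ eq _ = ⊥-elim (<-irrefl (cong toℕ injective) (inc s t (proj₁ mg)))
      where
      injective : ι s ≡ ι t
      injective = trans (sym (inverseˡ π)) (trans (cong (π ⟨$⟩ˡ_) eq) (inverseˡ π))

    merge-left : Embedded x π → Embedded z π
    merge-left (ι , inc , ord) = ι , inc , λ i j → ord i j ∘ proj₁ ∘ proj₁ (proj₂ mg i j)

    merge-right : Embedded y π → Embedded z π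
    merge-right (ι , inc , ord) = ι , inc , λ i j → ord i j ∘ proj₂ ∘ proj₁ (proj₂ mg i j)

  p3321 p46718234 p46781234 : Pattern
  p3321     = 3 ∷ 3 ∷ 2 ∷ 1 ∷ []
  p46718234 = 4 ∷ 6 ∷ 7 ∷ 1 ∷ 8 ∷ 2 ∷ 3 ∷ 4 ∷ []
  p46781234 = 4 ∷ 6 ∷ 7 ∷ 8 ∷ 1 ∷ 2 ∷ 3 ∷ 4 ∷ []

  merge-3321 : Merges (# 0) (# 1) (lookup p3321)
    (lookup (3 ∷ 4 ∷ 2 ∷ 1 ∷ [])) (lookup (4 ∷ 3 ∷ 2 ∷ 1 ∷ []))
  merge-3321 = toWitness {a? = merges? _ _ (lookup p3321) _ _} _

  merge-46718234 : Merges (# 0) (# 7) (lookup p46718234)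
    (lookup (4 ∷ 6 ∷ 7 ∷ 1 ∷ 8 ∷ 2 ∷ 3 ∷ 5 ∷ [])) (lookup (5 ∷ 6 ∷ 7 ∷ 1 ∷ 8 ∷ 2 ∷ 3 ∷ 4 ∷ []))
  merge-46718234 = toWitness {a? = merges? _ _ (lookup p46718234) _ _} _

  merge-46781234 : Merges (# 0) (# 7) (lookup p46781234)
    (lookup (4 ∷ 6 ∷ 7 ∷ 8 ∷ 1 ∷ 2 ∷ 3 ∷ 5 ∷ [])) (lookup (5 ∷ 6 ∷ 7 ∷ 8 ∷ 1 ∷ 2 ∷ 3 ∷ 4 ∷ []))
  merge-46781234 = toWitness {a? = merges? _ _ (lookup p46781234) _ _} _

  clusteredForms braidedForms : List Pattern
  clusteredForms = p3321 ∷ (4 ∷ 3 ∷ 1 ∷ 2 ∷ []) ∷ p46718234 ∷ p46781234 ∷ []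
  braidedForms   = (4 ∷ 2 ∷ 3 ∷ 1 ∷ []) ∷ clusteredForms

  module _ {n : ℕ} (π : Permutation′ n) where

    ⊨-contains : ∀ p → Contains p π → word π ⊨ whole n p
    ⊨-contains p = Embedded⇒⊨ π p ∘ Contains⇒Embedded π p

    embedded-contains : ∀ p {_ : True (distinct? p)} → Embedded (lookup p) π → Contains p π
    embedded-contains p {d} = Embedded⇒Contains π p (toWitness d)

    clustered⁻ : MaximallyClustered π × HexagonAvoiding π → ¬ Hit (word π) (map (whole n) clusteredForms)
    clustered⁻ (¬3421 ∷ ¬4312 ∷ ¬4321 ∷ [] , ¬h₁ ∷ ¬h₂ ∷ ¬h₃ ∷ ¬h₄ ∷ []) = λ
      { (here i)                         →
          [ ¬3421 ∘ embedded-contains _ , ¬4321 ∘ embedded-contains _ ]′ (merge-split merge-3321 π (⊨⇒Embedded π _ i))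
      ; (there (here i))                 → ¬4312 (embedded-contains _ (⊨⇒Embedded π _ i))
      ; (there (there (here i)))         →
          [ ¬h₁ ∘ embedded-contains _ , ¬h₃ ∘ embedded-contains _ ]′ (merge-split merge-46718234 π (⊨⇒Embedded π _ i))
      ; (there (there (there (here i)))) →
          [ ¬h₂ ∘ embedded-contains _ , ¬h₄ ∘ embedded-contains _ ]′ (merge-split merge-46781234 π (⊨⇒Embedded π _ i)) }

    clustered⁺ : ¬ Hit (word π) (map (whole n) clusteredForms) → MaximallyClustered π × HexagonAvoiding π
    clustered⁺ ¬i =
      (¬i ∘ here ∘ Embedded⇒⊨ π _ ∘ merge-left merge-3321 π ∘ Contains⇒Embedded π _) ∷
      (¬i ∘ there ∘ here ∘ ⊨-contains _) ∷
      (¬i ∘ here ∘ Embedded⇒⊨ π _ ∘ merge-right merge-3321 π ∘ Contains⇒Embedded π _) ∷ [] ,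
      (¬i ∘ there ∘ there ∘ here ∘ Embedded⇒⊨ π _ ∘ merge-left merge-46718234 π ∘ Contains⇒Embedded π _) ∷
      (¬i ∘ there ∘ there ∘ there ∘ here ∘ Embedded⇒⊨ π _ ∘ merge-left merge-46781234 π ∘ Contains⇒Embedded π _) ∷
      (¬i ∘ there ∘ there ∘ here ∘ Embedded⇒⊨ π _ ∘ merge-right merge-46718234 π ∘ Contains⇒Embedded π _) ∷
      (¬i ∘ there ∘ there ∘ there ∘ here ∘ Embedded⇒⊨ π _ ∘ merge-right merge-46781234 π ∘ Contains⇒Embedded π _) ∷ []

    braided⁻ : FreelyBraided π × HexagonAvoiding π → ¬ Hit (word π) (map (whole n) braidedForms)
    braided⁻ (¬4231 ∷ mc , hex) (here i)  = ¬4231 (embedded-contains _ (⊨⇒Embedded π _ i))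
    braided⁻ (¬4231 ∷ mc , hex) (there i) = clustered⁻ (mc , hex) i

    braided⁺ : ¬ Hit (word π) (map (whole n) braidedForms) → FreelyBraided π × HexagonAvoiding π
    braided⁺ ¬i with clustered⁺ (¬i ∘ there)
    ... | mc , hex = (¬i ∘ here ∘ ⊨-contains _) ∷ mc , hex

  -- The two classes and their recurrences

  initialState : List Pattern → State
  initialState ps = 1 , map (whole 1) ps

  ∑ᶜ-one : ∀ n h → ∑ᶜ 1 (suc n) h ≡ h (suc n ∷ [])
  ∑ᶜ-one zero    h = refl
  ∑ᶜ-one (suc n) h = ∑ᶜ-one n λ { [] → h [] ; (x ∷ g) → h (suc x ∷ g) }

  inst-whole : ∀ n ps → inst (n ∷ []) (map (whole 1) ps) ≡ map (whole n) ps
  inst-whole n ps = trans (sym (Listₚ.map-∘ ps)) (Listₚ.map-cong (λ p → trans (sym (Listₚ.map-∘ p))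
    (Listₚ.map-cong (λ a → cong (letter a 0) (+-identityʳ n)) p)) ps)

  -- The length is positive because the initial state has one slot, which must be nonempty: at
  -- length 0 `completions` gives 0, although there is one empty permutation.
  completions-initial : ∀ ps n →
    completions (outcome (initialState ps)) (suc n) ≡ number (map (whole (suc n)) ps) (suc n)
  completions-initial ps n = trans (completions-outcome (initialState ps) (suc n))
    (trans (∑ᶜ-one n λ g → number (inst g (map (whole 1) ps)) (suc n))
      (cong (λ A → number A (suc n)) (inst-whole (suc n) ps)))

  b-completions : ∀ n → completions (outcome (initialState braidedForms)) (suc n) ≡ b (suc n)
  b-completions n = trans (completions-initial braidedForms n)
    (count-cong {suc n} (misses? (map (whole (suc n)) braidedForms)) _ braided⁺ braided⁻)

  m-completions : ∀ n → completions (outcome (initialState clusteredForms)) (suc n) ≡ m (suc n)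
  m-completions n = trans (completions-initial clusteredForms n)
    (count-cong {suc n} (misses? (map (whole (suc n)) clusteredForms)) _ clustered⁺ clustered⁻)

  -- Coefficients by increasing index.  The cofactors are the minimal polynomials of the vectors w at valid?,
  -- without their leading coefficients.
  braidedRecurrence braidedCofactor braidedValues clusteredRecurrence clusteredCofactor clusteredValues : List ℤ
  braidedRecurrence   = - + 1 ∷ + 1 ∷ + 8 ∷ - + 1 ∷ - + 3 ∷ + 9 ∷ - + 6 ∷ + 1 ∷ []
  braidedCofactor     = + 0 ∷ + 1 ∷ - + 2 ∷ - + 1 ∷ + 5 ∷ - + 4 ∷ []
  braidedValues       = + 6 ∷ + 20 ∷ + 71 ∷ + 260 ∷ + 971 ∷ + 3670 ∷ + 13968 ∷ []
  clusteredRecurrence = - + 3 ∷ + 4 ∷ + 8 ∷ - + 14 ∷ + 15 ∷ - + 7 ∷ + 1 ∷ []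
  clusteredCofactor   = + 2 ∷ - + 7 ∷ + 9 ∷ - + 5 ∷ []
  clusteredValues     = + 6 ∷ + 21 ∷ + 78 ∷ + 298 ∷ + 1157 ∷ + 4535 ∷ + 17872 ∷ []

  record Certificate (p cs vs : List ℤ) (n₀ : ℕ) (q : State) : Set where
    constructor certificate
    field valid : valid? p cs vs n₀ q (automaton q) ≡ true

  record Solves (p vs : List ℤ) (n₀ : ℕ) (c : ℕ → ℕ) : Set where
    constructor solves
    field
      values     : map (+_ ∘ c) (applyUpTo (_+ 3) (length vs)) ≡ vs
      recurrence : ∀ n → (p ⟨ +_ ∘ c ⟩) (n₀ + n) ≡ 0ℤ

  ⟨⟩-cong : ∀ p {f g} → (∀ n → f (suc n) ≡ g (suc n)) → ∀ n → (p ⟨ f ⟩) (suc n) ≡ (p ⟨ g ⟩) (suc n)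
  ⟨⟩-cong []      eq n = refl
  ⟨⟩-cong (c ∷ p) eq n = cong₂ (λ x y → c ℤ.* x ℤ.+ y) (eq n) (⟨⟩-cong p eq (suc n))

  certificate-sound : ∀ {p cs vs n₀ q} → Certificate p cs vs (suc n₀) q →
                      ∀ c → (∀ n → completions q (suc n) ≡ c (suc n)) → Solves p vs (suc n₀) c
  certificate-sound {p} {cs} {vs} {n₀} {q} (certificate valid) c eq
    with valid-sound p cs vs (suc n₀) q (automaton q) (subst T (sym valid) _)
  ... | values , recurrence = solves
    (trans (sym (applied (length vs) _ (λ i → i + 2) (λ i → +-suc i 2))) values)
    λ n → trans (sym (⟨⟩-cong p (cong +_ ∘ eq) (n₀ + n))) (recurrence n)
    where
    applied : ∀ n h (k : ℕ → ℕ) → (∀ i → h i ≡ suc (k i)) →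
              map (+_ ∘ completions q) (applyUpTo h n) ≡ map (+_ ∘ c) (applyUpTo h n)
    applied zero    h k hk = refl
    applied (suc n) h k hk = cong₂ _∷_
      (cong +_ (trans (cong (completions q) (hk 0)) (trans (eq (k 0)) (cong c (sym (hk 0))))))
      (applied n (h ∘ suc) (k ∘ suc) (hk ∘ suc))

  solved : ∀ {x y r} → x ≡ r ℤ.+ y → y ≡ 0ℤ → x ≡ r
  solved {r = r} eq refl = trans eq (ℤₚ.+-identityʳ r)

  module _ (x₀ x₁ x₂ x₃ x₄ x₅ x₆ x₇ : ℤ) where

    braided-solved : - + 1 ℤ.* x₀ ℤ.+ (+ 1 ℤ.* x₁ ℤ.+ (+ 8 ℤ.* x₂ ℤ.+ (- + 1 ℤ.* x₃ ℤ.+ (- + 3 ℤ.* x₄ ℤ.+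
         (+ 9 ℤ.* x₅ ℤ.+ (- + 6 ℤ.* x₆ ℤ.+ (+ 1 ℤ.* x₇ ℤ.+ 0ℤ))))))) ≡ 0ℤ →
      x₇ ≡ + 6 ℤ.* x₆ ℤ.- + 9 ℤ.* x₅ ℤ.+ + 3 ℤ.* x₄ ℤ.+ x₃ ℤ.- + 8 ℤ.* x₂ ℤ.- x₁ ℤ.+ x₀
    braided-solved = solved (identity x₀ x₁ x₂ x₃ x₄ x₅ x₆ x₇)
      where
      identity : ∀ x₀ x₁ x₂ x₃ x₄ x₅ x₆ x₇ →
        x₇ ≡ + 6 ℤ.* x₆ ℤ.- + 9 ℤ.* x₅ ℤ.+ + 3 ℤ.* x₄ ℤ.+ x₃ ℤ.- + 8 ℤ.* x₂ ℤ.- x₁ ℤ.+ x₀ ℤ.+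
        (- + 1 ℤ.* x₀ ℤ.+ (+ 1 ℤ.* x₁ ℤ.+ (+ 8 ℤ.* x₂ ℤ.+ (- + 1 ℤ.* x₃ ℤ.+ (- + 3 ℤ.* x₄ ℤ.+
         (+ 9 ℤ.* x₅ ℤ.+ (- + 6 ℤ.* x₆ ℤ.+ (+ 1 ℤ.* x₇ ℤ.+ 0ℤ))))))))
      identity = solve-∀

  module _ (x₀ x₁ x₂ x₃ x₄ x₅ x₆ : ℤ) where

    clustered-solved : - + 3 ℤ.* x₀ ℤ.+ (+ 4 ℤ.* x₁ ℤ.+ (+ 8 ℤ.* x₂ ℤ.+ (- + 14 ℤ.* x₃ ℤ.+
         (+ 15 ℤ.* x₄ ℤ.+ (- + 7 ℤ.* x₅ ℤ.+ (+ 1 ℤ.* x₆ ℤ.+ 0ℤ)))))) ≡ 0ℤ →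
      x₆ ≡ + 7 ℤ.* x₅ ℤ.- + 15 ℤ.* x₄ ℤ.+ + 14 ℤ.* x₃ ℤ.- + 8 ℤ.* x₂ ℤ.- + 4 ℤ.* x₁ ℤ.+ + 3 ℤ.* x₀
    clustered-solved = solved (identity x₀ x₁ x₂ x₃ x₄ x₅ x₆)
      where
      identity : ∀ x₀ x₁ x₂ x₃ x₄ x₅ x₆ →
        x₆ ≡ + 7 ℤ.* x₅ ℤ.- + 15 ℤ.* x₄ ℤ.+ + 14 ℤ.* x₃ ℤ.- + 8 ℤ.* x₂ ℤ.- + 4 ℤ.* x₁ ℤ.+ + 3 ℤ.* x₀ ℤ.+
        (- + 3 ℤ.* x₀ ℤ.+ (+ 4 ℤ.* x₁ ℤ.+ (+ 8 ℤ.* x₂ ℤ.+ (- + 14 ℤ.* x₃ ℤ.+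
         (+ 15 ℤ.* x₄ ℤ.+ (- + 7 ℤ.* x₅ ℤ.+ (+ 1 ℤ.* x₆ ℤ.+ 0ℤ)))))))
      identity = solve-∀

  Recurrences : (b m : ℕ → ℕ) → ℕ → Set
  Recurrences b m n =
      (+ b (suc n) ≡ + 6 ℤ.* + b n ℤ.- + 9 ℤ.* + b (n ∸ 1) ℤ.+ + 3 ℤ.* + b (n ∸ 2) ℤ.+ + b (n ∸ 3)
      ℤ.- + 8 ℤ.* + b (n ∸ 4) ℤ.- + b (n ∸ 5) ℤ.+ + b (n ∸ 6))
      × (+ m (suc n) ≡ + 7 ℤ.* + m n ℤ.- + 15 ℤ.* + m (n ∸ 1) ℤ.+ + 14 ℤ.* + m (n ∸ 2) ℤ.- + 8 ℤ.* + m (n ∸ 3)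
      ℤ.- + 4 ℤ.* + m (n ∸ 4) ℤ.+ + 3 ℤ.* + m (n ∸ 5))

  -- The starting points 3 and 4 are the smallest indices at `n = 9`, namely 9 - 6 for `b` and 9 - 5
  -- for `m`.
  recurrences : ∀ {b m} → Solves braidedRecurrence braidedValues 3 b → Solves clusteredRecurrence clusteredValues 4 m →
                ∀ n → 9 ≤ n → Recurrences b m n
  recurrences {b} {m} (solves _ rb) (solves _ rm) n 9≤n = subst (Recurrences b m) (m+[n∸m]≡n 9≤n)
    (braided-solved (x 3) (x 4) (x 5) (x 6) (x 7) (x 8) (x 9) (x 10) (rb (n ∸ 9)) ,
     clustered-solved (y 4) (y 5) (y 6) (y 7) (y 8) (y 9) (y 10) (rm (n ∸ 9)))
    where
    x y : ℕ → ℤ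
    x i = + b (i + (n ∸ 9))
    y i = + m (i + (n ∸ 9))

  first-values : ∀ {p c n₀ x₃ x₄ x₅ x₆ x₇ x₈ x₉} →
    Solves p (+ x₃ ∷ + x₄ ∷ + x₅ ∷ + x₆ ∷ + x₇ ∷ + x₈ ∷ + x₉ ∷ []) n₀ c →
    c 3 ≡ x₃ × c 4 ≡ x₄ × c 5 ≡ x₅ × c 6 ≡ x₆ × c 7 ≡ x₇ × c 8 ≡ x₈ × c 9 ≡ x₉
  first-values {c = c} (solves eq _) with c 3 | c 4 | c 5 | c 6 | c 7 | c 8 | c 9 | eq
  ... | _ | _ | _ | _ | _ | _ | _ | refl = refl , refl , refl , refl , refl , refl , refl

  b-solves : Solves braidedRecurrence braidedValues 3 b
  b-solves =
    certificate-sound {cs = braidedCofactor} {q = outcome (initialState braidedForms)} (certificate refl) b b-completions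

  m-solves : Solves clusteredRecurrence clusteredValues 4 m
  m-solves =
    certificate-sound {cs = clusteredCofactor} {q = outcome (initialState clusteredForms)} (certificate refl) m m-completions

open import Data.Integer using (+_; _+_; _-_; _*_)

corollary2p7 : (∀ (n : ℕ) → 9 ≤ n →
    (+ b (suc n) ≡ + 6 * + b n - + 9 * + b (n ∸ 1) + + 3 * + b (n ∸ 2) + + b (n ∸ 3)
    - + 8 * + b (n ∸ 4) - + b (n ∸ 5) + + b (n ∸ 6))
    × (+ m (suc n) ≡ + 7 * + m n - + 15 * + m (n ∸ 1) + + 14 * + m (n ∸ 2) - + 8 * + m (n ∸ 3)
    - + 4 * + m (n ∸ 4) + + 3 * + m (n ∸ 5)))
    × (b 3 ≡ 6 × b 4 ≡ 20 × b 5 ≡ 71 × b 6 ≡ 260 × b 7 ≡ 971 × b 8 ≡ 3670 × b 9 ≡ 13968)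
    × (m 3 ≡ 6 × m 4 ≡ 21 × m 5 ≡ 78 × m 6 ≡ 298 × m 7 ≡ 1157 × m 8 ≡ 4535 × m 9 ≡ 17872)
corollary2p7 = recurrences b-solves m-solves , first-values b-solves , first-values m-solves
  where
  open import Data.Product using (_,_)
  open Enumeration
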